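{- Let $\mathbb T$ be a theory. Then: (1) if $\Theta;\Gamma\vdash\vec v:\Delta$ and $\Theta;\Delta\vdash\mathcal J$, then $\Theta;\Gamma\vdash\mathcal J[\vec v]$; (2) if $\Xi;\Gamma\vdash\mathbf v:\Theta$ and $\Theta;\Delta\vdash\mathcal J$, then $\Xi;\Gamma.\Delta[\mathbf v]\vdash\mathcal J[\mathbf v]_\Gamma$. Here $\vdash\mathcal J$ ranges over the five forms $\vdash$ , $\vdash T\ \mathsf{sort}$, $\vdash t:T$, $\vdash\vec t:\Delta'$, $\vdash\mathbf t:\Xi'$. The corresponding $\vdash\mathcal J[\vec v]$ is, respectively, $\vdash$ , $\vdash T[\vec v]\ \mathsf{sort}$, $\vdash t[\vec v]:T[\vec v]$, $\vdash\vec t[\vec v]:\Delta'$, $\vdash\mathbf t[\vec v]:\Xi'$; and the corresponding $\vdash\mathcal J[\mathbf v]_\Gamma$ is, respectively, $\vdash$ , $\vdash T[\mathbf v]\ \mathsf{sort}$, $\vdash t[\mathbf v]:T[\mathbf v]$, $\vdash\mathsf{id}_{|\Gamma|},\vec t[\mathbf v]:\Gamma.\Delta'[\mathbf v]$, $\vdash\mathbf t[\mathbf v]:\Xi'$.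
   Context: **Syntax.** Expressions are taken up to renaming of bound variables (equivalently, de Bruijn indices) and implicitly weakened to larger scopes; concatenated scopes are regarded as disjoint. A scope $\gamma$ is a finite list of variables; a metavariable scope $\theta$ is a finite list of entries $\mathtt x\{\delta\}$ with $\delta$ a scope; a signature $\Sigma$ is a finite list of entries $o(\theta)$, where each operation $o$ is either a constructor (written $c$) or a destructor (written $d$). Concatenation is written with a dot, $\cdot$ is the empty list. For fixed $\Sigma$, by mutual induction: terms $\mathsf{Tm}\,\theta\,\gamma$ are $x$ ($x\in\gamma$), $\mathtt x\{\vec t\}$ ($\mathtt x\{\delta\}\in\theta$, $\vec t\in\mathsf{Sub}\,\theta\,\gamma\,\delta$), $o(\mathbf t)$ ($o(\xi)\in\Sigma$, $\mathbf t\in\mathsf{MSub}\,\theta\,\gamma\,\xi$); substitutions $\mathsf{Sub}\,\theta\,\gamma\,\delta$ are lists of terms in $\mathsf{Tm}\,\theta\,\gamma$, one $t_x$ for each $x\in\delta$; metavariable substitutions $\mathsf{MSub}\,\theta\,\gamma\,\xi$ are lists with one entry $\vec x_\delta.t$, $t\in\mathsf{Tm}\,\theta\,(\gamma.\delta)$ (variables of $\delta$ bound), for each $\mathtt x\{\delta\}\in\xi$, and $\mathbf t_{\mathtt x}$ denotes this $t$; $\varepsilon$ is the empty list. $\mathsf{Ctx}\,\theta\,\gamma$: lists $x_1:T_1,\dots,x_k:T_k$ with $T_i\in\mathsf{Tm}\,\theta\,(\gamma,x_1,\dots,x_{i-1})$; underlying scope $|\Gamma|=x_1,\dots,x_k$.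 $\mathsf{MCtx}\,\theta$: lists $\mathtt x_1\{\Gamma_1\}:T_1,\dots,\mathtt x_k\{\Gamma_k\}:T_k$ with $\Gamma_i\in\mathsf{Ctx}\,(\theta.\xi_i)\,(\cdot)$ and $T_i\in\mathsf{Tm}\,(\theta.\xi_i)\,|\Gamma_i|$, where $\xi_i=\mathtt x_1\{|\Gamma_1|\},\dots,\mathtt x_{i-1}\{|\Gamma_{i-1}|\}$; $|\Theta|=\mathtt x_1\{|\Gamma_1|\},\dots,\mathtt x_k\{|\Gamma_k|\}$. Abbreviate $\mathsf{Ctx}\,\theta=\mathsf{Ctx}\,\theta\,(\cdot)$, $\mathsf{Ctx}=\mathsf{Ctx}\,(\cdot)\,(\cdot)$, $\mathsf{MCtx}=\mathsf{MCtx}\,(\cdot)$. $\mathsf{id}_\gamma$ is the list of variables of $\gamma$. For $\vec v\in\mathsf{Sub}\,\theta\,\gamma_1\,\gamma_2$ and $e$ over $\theta,\gamma_2$, $e[\vec v]$ (over $\theta,\gamma_1$) is capture-avoiding simultaneous substitution. For $\mathbf v\in\mathsf{MSub}\,\theta_1\,\delta\,\theta_2$ and $e$ over $\theta_2,\gamma$, $e[\mathbf v]$ (over $\theta_1,\delta.\gamma$) is defined structurally by $x[\mathbf v]=x$, $\mathtt x\{\vec t\}[\mathbf v]=\mathbf v_{\mathtt x}[\mathsf{id}_\delta,\vec t[\mathbf v]]$, $o(\mathbf t)[\mathbf v]=o(\mathbf t[\mathbf v])$, componentwise on lists and contexts. **Patterns and theories.** $\mathsf{Tm}^{\mathsf P}\,\theta\,\gamma$: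 $\mathtt x\{\mathsf{id}_\gamma\}$ if $\theta$ is exactly $\mathtt x\{\gamma\}$; or $c(\mathbf t)$ with $c(\xi)\in\Sigma$ a constructor and $\mathbf t\in\mathsf{MSub}^{\mathsf P}\,\theta\,\gamma\,\xi$. $\mathsf{MSub}^{\mathsf P}\,\theta\,\gamma\,\xi$: $\varepsilon$ if $\xi=\theta=\cdot$; or $\mathbf t,\vec x_\delta.t$ if $\xi=\xi',\mathtt x\{\delta\}$, $\theta=\theta_1.\theta_2$, $\mathbf t\in\mathsf{MSub}^{\mathsf P}\,\theta_1\,\gamma\,\xi'$, $t\in\mathsf{Tm}^{\mathsf P}\,\theta_2\,(\gamma.\delta)$. A theory $\mathbb T$, with underlying signature $|\mathbb T|$, is built from the empty theory by successively adding entries over the current signature (declared symbols pairwise distinct): sort rules $c(\Xi)\ \mathsf{sort}$ with $\Xi\in\mathsf{MCtx}$ (adds $c(|\Xi|)$ to the signature); constructor rules $c(\Xi_p;\Xi_c;\mathbf v_i/\Xi_i):T$ with $\Xi_p\in\mathsf{MCtx}$, $\Xi_c,\Xi_i\in\mathsf{MCtx}\,|\Xi_p|$, $\mathbf v_i\in\mathsf{MSub}\,|\Xi_p.\Xi_c|\,(\cdot)\,|\Xi_i|$, $T\in\mathsf{Tm}^{\mathsf P}\,|\Xi_p.\Xi_i|\,(\cdot)$ (adds $c(|\Xi_c|)$); destructor rules $d(\Xi_{pi};\mathtt x:T;\Xi_d):U$ with $\Xi_{pi}\in\mathsf{MCtx}$, $T\in\mathsf{Tm}^{\mathsf P}\,|\Xi_{pi}|\,(\cdot)$,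 $\Xi_d\in\mathsf{MCtx}\,|\Xi_{pi},\mathtt x:T|$, $U\in\mathsf{Tm}\,|\Xi_{pi}.(\mathtt x:T).\Xi_d|\,(\cdot)$ (adds $d(\mathtt x,|\Xi_d|)$); rewrite rules $\theta\Vdash d(\mathbf t)\longmapsto r$ with $d(\xi)\in|\mathbb T|$, $\mathbf t\in\mathsf{MSub}^{\mathsf P}\,\theta\,(\cdot)\,\xi$, $r\in\mathsf{Tm}\,\theta\,(\cdot)$, such that $\mathbf t[\mathbf u]\ne\mathbf t'[\mathbf u']$ for every earlier rule $\theta'\Vdash d(\mathbf t')\longmapsto r'$ and all $\mathbf u,\mathbf u'$. The relation $\longrightarrow$ is the closure under all expression formers (one component at a time, also under binders and in contexts) of $d(\mathbf u[\mathbf t])\longrightarrow r[\mathbf t]$ for $(\theta_0\Vdash d(\mathbf u)\longmapsto r)\in\mathbb T$, $\mathbf t\in\mathsf{MSub}\,\theta\,\gamma\,\theta_0$; $\equiv$ is its reflexive-symmetric-transitive closure. **Declarative typing** (inductively defined; $\Theta\in\mathsf{MCtx}$, $\Gamma,\Delta\in\mathsf{Ctx}\,|\Theta|$, $\Xi\in\mathsf{MCtx}$). $\cdot\vdash$; $\Theta,\mathtt x\{\Gamma\}:T\vdash$ if $\Theta;\Gamma\vdash T\ \mathsf{sort}$. $\Theta;\cdot\vdash$ if $\Theta\vdash$; $\Theta;\Gamma,x:T\vdash$ if $\Theta;\Gamma\vdash T\ \mathsf{sort}$. Sort: $\Theta;\Gamma\vdash c(\mathbf t)\ \mathsf{sort}$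 if $c(\Xi)\ \mathsf{sort}\in\mathbb T$ and $\Theta;\Gamma\vdash\mathbf t:\Xi$. Var: $\Theta;\Gamma\vdash x:T$ if $x:T\in\Gamma$ and $\Theta;\Gamma\vdash$. MVar: $\Theta;\Gamma\vdash\mathtt x\{\vec t\}:T[\vec t]$ if $\mathtt x\{\Delta\}:T\in\Theta$ and $\Theta;\Gamma\vdash\vec t:\Delta$. Cons: $\Theta;\Gamma\vdash c(\mathbf t):T[\mathbf t_p,\mathbf v_i[\mathbf t_p,\mathbf t]]$ if $c(\Xi_p;\Xi_c;\mathbf v_i/\Xi_i):T\in\mathbb T$, $\Theta;\Gamma\vdash\mathbf t_p,\mathbf t:\Xi_p.\Xi_c$ and $\Theta;\Gamma\vdash T[\mathbf t_p,\mathbf v_i[\mathbf t_p,\mathbf t]]\ \mathsf{sort}$. Dest: $\Theta;\Gamma\vdash d(\mathbf t):U[\mathbf t_{pi},\mathbf t]$ if $d(\Xi_{pi};\mathtt x:T;\Xi_d):U\in\mathbb T$ and $\Theta;\Gamma\vdash\mathbf t_{pi},\mathbf t:\Xi_{pi}.(\mathtt x:T).\Xi_d$. Conv: $\Theta;\Gamma\vdash t:U$ if $\Theta;\Gamma\vdash t:T$, $T\equiv U$, $\Theta;\Gamma\vdash U\ \mathsf{sort}$. Substitutions: $\Theta;\Gamma\vdash\varepsilon:(\cdot)$ if $\Theta;\Gamma\vdash$; $\Theta;\Gamma\vdash\vec t,t:(\Delta,x:T)$ if $\Theta;\Gamma\vdash\vec t:\Delta$ and $\Theta;\Gamma\vdash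 t:T[\vec t]$. Metavariable substitutions: $\Theta;\Gamma\vdash\varepsilon:(\cdot)$ if $\Theta;\Gamma\vdash$; $\Theta;\Gamma\vdash\mathbf t,\vec x_\Delta.t:(\Xi,\mathtt x\{\Delta\}:T)$ if $\Theta;\Gamma\vdash\mathbf t:\Xi$ and $\Theta;\Gamma.\Delta[\mathbf t]\vdash t:T[\mathbf t]$. -}

module Defs where

open import Data.Fin using (Fin; zero; suc; lift; _↑ˡ_; _↑ʳ_)
open import Data.List using (List; []; _∷_; _++_) renaming (map to mapᴸ)
open import Data.List.Membership.Propositional using (_∈_)
open import Data.List.Membership.Propositional.Properties using (∈-++⁺ˡ; ∈-++⁺ʳ)
open import Data.List.Relation.Binary.Subset.Propositional using (_⊆_)
open import Data.List.Relation.Unary.All using (All; []; _∷_) renaming (lookup to lookupᴬ)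
open import Data.List.Relation.Unary.All.Properties using (++⁺)
open import Data.List.Relation.Unary.Any using (here; there)
open import Data.Nat using (ℕ; zero; suc; _+_)
open import Data.Product using (_×_; _,_; proj₁; proj₂)
open import Data.Vec using (Vec; []; _∷_; lookup; tabulate) renaming (map to mapⱽ; _++_ to _++ⱽ_)
open import Function using (id; _∘_)
open import Relation.Binary.Construct.Closure.Equivalence using (EqClosure)
open import Relation.Binary.PropositionalEquality using (_≡_; _≢_; refl)

-- De Bruijn conventions.  All lists (scopes, signatures, substitutions) grow at
-- the head: index zero is the most recently declared entry.  Hence the
-- concatenation γ.δ of scopes is δ + γ, and θ.θ′ is θ′ ++ θ.  A variable i of γ
-- becomes δ ↑ʳ i in γ.δ, and a variable i of δ becomes i ↑ˡ γ.

Scope : Set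
Scope = ℕ

MScope : Set
MScope = List Scope

data Op : Set where
  con des : MScope → Op

arity : Op → MScope
arity (con ξ) = ξ
arity (des ξ) = ξ

-- Symbols are positions in the signature, so distinct declarations always
-- introduce distinct symbols.

Sig : Set
Sig = List Op

variable
  Σ Σ′ : Sig
  θ θ′ θ₁ θ₂ ξ θp θc θi θd : MScope
  γ γ′ γ₁ γ₂ δ κ : Scope
  o : Op

------------------------------------------------------------------------
-- Syntax

data Tm (Σ : Sig) (θ : MScope) (γ : Scope) : Set where
  var  : Fin γ → Tm Σ θ γ
  mvar : δ ∈ θ → Vec (Tm Σ θ γ) δ → Tm Σ θ γ
  op   : o ∈ Σ → All (λ δ → Tm Σ θ (δ + γ)) (arity o) → Tm Σ θ γ

Sub : Sig → MScope → Scope → Scope → Set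
Sub Σ θ γ δ = Vec (Tm Σ θ γ) δ

MSub : Sig → MScope → Scope → MScope → Set
MSub Σ θ γ ξ = All (λ δ → Tm Σ θ (δ + γ)) ξ

-- Telescopes are indexed by the scope they start from and the scope they end
-- in; for those starting from the empty scope the end is the underlying scope.

data Tel (Σ : Sig) (θ : MScope) (γ : Scope) : Scope → Set where
  ε   : Tel Σ θ γ γ
  _▹_ : Tel Σ θ γ γ′ → Tm Σ θ γ′ → Tel Σ θ γ (suc γ′)

Ctx : Sig → MScope → Scope → Set
Ctx Σ θ γ = Tel Σ θ 0 γ

data MTel (Σ : Sig) (θ : MScope) : MScope → Set where
  ε     : MTel Σ θ θ
  _▹_⦂_ : MTel Σ θ θ′ → Ctx Σ θ′ δ → Tm Σ θ′ δ → MTel Σ θ (δ ∷ θ′)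

MCtx : Sig → MScope → Set
MCtx Σ θ = MTel Σ [] θ

infixl 5 _▹_ _▹_⦂_ _▹▹_ _▹▹ᵐ_

_▹▹_ : Tel Σ θ γ γ₁ → Tel Σ θ γ₁ γ₂ → Tel Σ θ γ γ₂
Γ ▹▹ ε       = Γ
Γ ▹▹ (Δ ▹ T) = (Γ ▹▹ Δ) ▹ T

_▹▹ᵐ_ : MTel Σ θ θ₁ → MTel Σ θ₁ θ₂ → MTel Σ θ θ₂
Θ ▹▹ᵐ ε           = Θ
Θ ▹▹ᵐ (Ξ ▹ Γ ⦂ T) = (Θ ▹▹ᵐ Ξ) ▹ Γ ⦂ T

-- The list 𝐭 , 𝐮 in MSub (θ₁.θ₂).

infixl 5 _⨾_

_⨾_ : MSub Σ θ γ θ₁ → MSub Σ θ γ θ₂ → MSub Σ θ γ (θ₂ ++ θ₁)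
𝐭 ⨾ 𝐮 = ++⁺ 𝐮 𝐭

------------------------------------------------------------------------
-- Weakening: implicit in the informal syntax, here simultaneous in the
-- signature, the metavariable scope and the scope.

wk  : Σ ⊆ Σ′ → θ ⊆ θ′ → (Fin γ → Fin γ′) → Tm Σ θ γ → Tm Σ′ θ′ γ′
wkˢ : Σ ⊆ Σ′ → θ ⊆ θ′ → (Fin γ → Fin γ′) → Sub Σ θ γ δ → Sub Σ′ θ′ γ′ δ
wkᵐ : Σ ⊆ Σ′ → θ ⊆ θ′ → (Fin γ → Fin γ′) → MSub Σ θ γ ξ → MSub Σ′ θ′ γ′ ξ

wk s m r (var x)     = var (r x)
wk s m r (mvar x ts) = mvar (m x) (wkˢ s m r ts)
wk s m r (op o 𝐭)    = op (s o) (wkᵐ s m r 𝐭)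

wkˢ s m r []       = []
wkˢ s m r (t ∷ ts) = wk s m r t ∷ wkˢ s m r ts

wkᵐ s m r []                = []
wkᵐ s m r (_∷_ {x = δ} t 𝐭) = wk s m (lift δ r) t ∷ wkᵐ s m r 𝐭

ren : (Fin γ → Fin γ′) → Tm Σ θ γ → Tm Σ θ γ′
ren = wk id id

wkᵗ : Σ ⊆ Σ′ → θ ⊆ θ′ → Tel Σ θ γ γ′ → Tel Σ′ θ′ γ γ′
wkᵗ s m ε       = ε
wkᵗ s m (Γ ▹ T) = wkᵗ s m Γ ▹ wk s m id T

wkᵐᵗ : Σ ⊆ Σ′ → MTel Σ θ θ′ → MTel Σ′ θ θ′
wkᵐᵗ s ε           = ε
wkᵐᵗ s (Θ ▹ Γ ⦂ T) = wkᵐᵗ s Θ ▹ wkᵗ s id Γ ⦂ wk s id id T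

------------------------------------------------------------------------
-- Substitution

idˢ : Sub Σ θ γ γ
idˢ = tabulate var

↑ˢ : ∀ δ → Sub Σ θ γ₁ γ₂ → Sub Σ θ (δ + γ₁) (δ + γ₂)
↑ˢ {γ₁ = γ₁} δ vs = tabulate (λ i → var (i ↑ˡ γ₁)) ++ⱽ mapⱽ (ren (δ ↑ʳ_)) vs

infixl 8 _[_] _[_]ˢ _[_]ᵐ

_[_]  : Tm Σ θ γ₂ → Sub Σ θ γ₁ γ₂ → Tm Σ θ γ₁
_[_]ˢ : Sub Σ θ γ₂ δ → Sub Σ θ γ₁ γ₂ → Sub Σ θ γ₁ δ
_[_]ᵐ : MSub Σ θ γ₂ ξ → Sub Σ θ γ₁ γ₂ → MSub Σ θ γ₁ ξ

var x     [ vs ] = lookup vs x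
mvar x ts [ vs ] = mvar x (ts [ vs ]ˢ)
op o 𝐭    [ vs ] = op o (𝐭 [ vs ]ᵐ)

[]       [ vs ]ˢ = []
(t ∷ ts) [ vs ]ˢ = t [ vs ] ∷ ts [ vs ]ˢ

[]                [ vs ]ᵐ = []
(_∷_ {x = δ} t 𝐭) [ vs ]ᵐ = t [ ↑ˢ δ vs ] ∷ 𝐭 [ vs ]ᵐ

------------------------------------------------------------------------
-- Metavariable substitution

-- For an expression e over γ and 𝐯 over δ, the target δ.γ is generalised to a
-- scope κ with inclusions ρ of δ and σ of γ, because under a binder the
-- scopes (δ.γ).δ′ and δ.(γ.δ′) do not agree definitionally.  The list
-- tabulate (var ∘ ρ) is id_δ weakened to κ.

msub  : MSub Σ θ₁ δ θ₂ → (Fin δ → Fin κ) → (Fin γ → Fin κ) → Tm Σ θ₂ γ → Tm Σ θ₁ κ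
msubˢ : MSub Σ θ₁ δ θ₂ → (Fin δ → Fin κ) → (Fin γ → Fin κ) → Sub Σ θ₂ γ γ′ → Sub Σ θ₁ κ γ′
msubᵐ : MSub Σ θ₁ δ θ₂ → (Fin δ → Fin κ) → (Fin γ → Fin κ) → MSub Σ θ₂ γ ξ → MSub Σ θ₁ κ ξ

msub 𝐯 ρ σ (var x)     = var (σ x)
msub 𝐯 ρ σ (mvar x ts) = lookupᴬ 𝐯 x [ msubˢ 𝐯 ρ σ ts ++ⱽ tabulate (var ∘ ρ) ]
msub 𝐯 ρ σ (op o 𝐭)    = op o (msubᵐ 𝐯 ρ σ 𝐭)

msubˢ 𝐯 ρ σ []       = []
msubˢ 𝐯 ρ σ (t ∷ ts) = msub 𝐯 ρ σ t ∷ msubˢ 𝐯 ρ σ ts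

msubᵐ 𝐯 ρ σ []                 = []
msubᵐ 𝐯 ρ σ (_∷_ {x = δ′} t 𝐭) = msub 𝐯 ((δ′ ↑ʳ_) ∘ ρ) (lift δ′ σ) t ∷ msubᵐ 𝐯 ρ σ 𝐭

infixl 8 _⟦_⟧ _⟦_⟧ˢ _⟦_⟧ᵐ _⟦_⟧ᵗ

_⟦_⟧ : Tm Σ θ₂ γ → MSub Σ θ₁ δ θ₂ → Tm Σ θ₁ (γ + δ)
_⟦_⟧ {γ = γ} {δ = δ} t 𝐯 = msub 𝐯 (γ ↑ʳ_) (_↑ˡ δ) t

_⟦_⟧ˢ : Sub Σ θ₂ γ γ′ → MSub Σ θ₁ δ θ₂ → Sub Σ θ₁ (γ + δ) γ′
_⟦_⟧ˢ {γ = γ} {δ = δ} ts 𝐯 = msubˢ 𝐯 (γ ↑ʳ_) (_↑ˡ δ) ts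

_⟦_⟧ᵐ : MSub Σ θ₂ γ ξ → MSub Σ θ₁ δ θ₂ → MSub Σ θ₁ (γ + δ) ξ
_⟦_⟧ᵐ {γ = γ} {δ = δ} 𝐭 𝐯 = msubᵐ 𝐯 (γ ↑ʳ_) (_↑ˡ δ) 𝐭

_⟦_⟧ᵗ : Tel Σ θ₂ γ γ′ → MSub Σ θ₁ δ θ₂ → Tel Σ θ₁ (γ + δ) (γ′ + δ)
ε       ⟦ 𝐯 ⟧ᵗ = ε
(Γ ▹ T) ⟦ 𝐯 ⟧ᵗ = Γ ⟦ 𝐯 ⟧ᵗ ▹ T ⟦ 𝐯 ⟧

------------------------------------------------------------------------
-- Patterns

data TmP (Σ : Sig) : MScope → Scope → Set
data MSubP (Σ : Sig) : MScope → Scope → MScope → Set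

data TmP Σ where
  mvar : TmP Σ (γ ∷ []) γ
  op   : con ξ ∈ Σ → MSubP Σ θ γ ξ → TmP Σ θ γ

data MSubP Σ where
  []  : MSubP Σ [] γ []
  _∷_ : TmP Σ θ₂ (δ + γ) → MSubP Σ θ₁ γ ξ → MSubP Σ (θ₂ ++ θ₁) γ (δ ∷ ξ)

⌜_⌝  : TmP Σ θ γ → Tm Σ θ γ
⌜_⌝ᵐ : MSubP Σ θ γ ξ → MSub Σ θ γ ξ

⌜ mvar ⌝   = mvar (here refl) idˢ
⌜ op c 𝐭 ⌝ = op c ⌜ 𝐭 ⌝ᵐ

⌜ [] ⌝ᵐ                = []
⌜ _∷_ {θ₂ = θ₂} t 𝐭 ⌝ᵐ = wk id ∈-++⁺ˡ id ⌜ t ⌝ ∷ wkᵐ id (∈-++⁺ʳ θ₂) id ⌜ 𝐭 ⌝ᵐ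

wkᴾ  : Σ ⊆ Σ′ → TmP Σ θ γ → TmP Σ′ θ γ
wkᵐᴾ : Σ ⊆ Σ′ → MSubP Σ θ γ ξ → MSubP Σ′ θ γ ξ

wkᴾ s mvar     = mvar
wkᴾ s (op c 𝐭) = op (s c) (wkᵐᴾ s 𝐭)

wkᵐᴾ s []      = []
wkᵐᴾ s (t ∷ 𝐭) = wkᴾ s t ∷ wkᵐᴾ s 𝐭

------------------------------------------------------------------------
-- Theories

record ConsRule (Σ : Sig) (θp θc θi : MScope) : Set where
  field
    Ξp : MCtx Σ θp
    Ξc : MTel Σ θp (θc ++ θp)
    Ξi : MTel Σ θp (θi ++ θp)
    𝐯i : MSub Σ (θc ++ θp) 0 θi
    T  : TmP Σ (θi ++ θp) 0

record DestRule (Σ : Sig) (θp θd : MScope) : Set where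
  field
    Ξp : MCtx Σ θp
    T  : TmP Σ θp 0
    Ξd : MTel Σ (0 ∷ θp) (θd ++ 0 ∷ θp)
    U  : Tm Σ (θd ++ 0 ∷ θp) 0

wkᶜ : Σ ⊆ Σ′ → ConsRule Σ θp θc θi → ConsRule Σ′ θp θc θi
wkᶜ s R = record
  { Ξp = wkᵐᵗ s Ξp ; Ξc = wkᵐᵗ s Ξc ; Ξi = wkᵐᵗ s Ξi ; 𝐯i = wkᵐ s id id 𝐯i ; T = wkᴾ s T }
  where open ConsRule R

wkᵈ : Σ ⊆ Σ′ → DestRule Σ θp θd → DestRule Σ′ θp θd
wkᵈ s R = record
  { Ξp = wkᵐᵗ s Ξp ; T = wkᴾ s T ; Ξd = wkᵐᵗ s Ξd ; U = wk s id id U }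
  where open DestRule R

data Rule (Σ : Sig) : Set where
  sortᴿ : con ξ ∈ Σ → MCtx Σ ξ → Rule Σ
  consᴿ : con θc ∈ Σ → ConsRule Σ θp θc θi → Rule Σ
  destᴿ : des (θd ++ 0 ∷ []) ∈ Σ → DestRule Σ θp θd → Rule Σ
  rewᴿ  : des ξ ∈ Σ → MSubP Σ θ 0 ξ → Tm Σ θ 0 → Rule Σ

wkᴿ : Σ ⊆ Σ′ → Rule Σ → Rule Σ′
wkᴿ s (sortᴿ c Ξ)  = sortᴿ (s c) (wkᵐᵗ s Ξ)
wkᴿ s (consᴿ c R)  = consᴿ (s c) (wkᶜ s R)
wkᴿ s (destᴿ d R)  = destᴿ (s d) (wkᵈ s R)
wkᴿ s (rewᴿ d 𝐭 r) = rewᴿ (s d) (wkᵐᴾ s 𝐭) (wk s id id r)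

NonOverlapping : List (Rule Σ) → des ξ ∈ Σ → MSubP Σ θ 0 ξ → Set
NonOverlapping {Σ} {ξ} {θ} Rs d 𝐭 =
  ∀ {θ′} (𝐭′ : MSubP Σ θ′ 0 ξ) (r′ : Tm Σ θ′ 0) → rewᴿ d 𝐭′ r′ ∈ Rs →
  ∀ {θ₀ γ} (𝐮 : MSub Σ θ₀ γ θ) (𝐮′ : MSub Σ θ₀ γ θ′) → ⌜ 𝐭 ⌝ᵐ ⟦ 𝐮 ⟧ᵐ ≢ ⌜ 𝐭′ ⌝ᵐ ⟦ 𝐮′ ⟧ᵐ

-- A theory is indexed by its underlying signature.  Each entry is formed over
-- the signature of the theory it extends; rules weakens all entries to the
-- signature of the whole theory.

data Theory : Sig → Set
rules : Theory Σ → List (Rule Σ)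

data Theory where
  ∅     : Theory []
  sort∷ : MCtx Σ ξ → Theory Σ → Theory (con ξ ∷ Σ)
  cons∷ : ConsRule Σ θp θc θi → Theory Σ → Theory (con θc ∷ Σ)
  dest∷ : DestRule Σ θp θd → Theory Σ → Theory (des (θd ++ 0 ∷ []) ∷ Σ)
  rew∷  : (d : des ξ ∈ Σ) (𝐭 : MSubP Σ θ 0 ξ) (r : Tm Σ θ 0) (𝕋 : Theory Σ) →
          NonOverlapping (rules 𝕋) d 𝐭 → Theory Σ

rules ∅                = []
rules (sort∷ Ξ 𝕋)      = sortᴿ (here refl) (wkᵐᵗ there Ξ) ∷ mapᴸ (wkᴿ there) (rules 𝕋)
rules (cons∷ R 𝕋)      = consᴿ (here refl) (wkᶜ there R) ∷ mapᴸ (wkᴿ there) (rules 𝕋)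
rules (dest∷ R 𝕋)      = destᴿ (here refl) (wkᵈ there R) ∷ mapᴸ (wkᴿ there) (rules 𝕋)
rules (rew∷ d 𝐭 r 𝕋 _) = rewᴿ d 𝐭 r ∷ rules 𝕋

------------------------------------------------------------------------
-- Rewriting and conversion.  Conversion is only ever used between terms, so
-- the closure stops at terms and the two kinds of substitutions inside them.

infix 3 _∣_⟶_ _∣_⟶ˢ_ _∣_⟶ᵐ_ _∣_≈_

data _∣_⟶_ (𝕋 : Theory Σ) {θ γ} : Tm Σ θ γ → Tm Σ θ γ → Set
data _∣_⟶ˢ_ (𝕋 : Theory Σ) {θ γ} : Sub Σ θ γ δ → Sub Σ θ γ δ → Set
data _∣_⟶ᵐ_ (𝕋 : Theory Σ) {θ γ} : MSub Σ θ γ ξ → MSub Σ θ γ ξ → Set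

data _∣_⟶_ {Σ} 𝕋 {θ} {γ} where
  root : {d : des ξ ∈ Σ} {𝐮 : MSubP Σ θ′ 0 ξ} {r : Tm Σ θ′ 0} →
         rewᴿ d 𝐮 r ∈ rules 𝕋 → (𝐭 : MSub Σ θ γ θ′) →
         𝕋 ∣ op d (⌜ 𝐮 ⌝ᵐ ⟦ 𝐭 ⟧ᵐ) ⟶ (r ⟦ 𝐭 ⟧)
  mvar : {x : δ ∈ θ} {ts ts′ : Sub Σ θ γ δ} →
         𝕋 ∣ ts ⟶ˢ ts′ → 𝕋 ∣ mvar x ts ⟶ mvar x ts′
  op   : {c : o ∈ Σ} {𝐭 𝐭′ : MSub Σ θ γ (arity o)} →
         𝕋 ∣ 𝐭 ⟶ᵐ 𝐭′ → 𝕋 ∣ op c 𝐭 ⟶ op c 𝐭′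

data _∣_⟶ˢ_ {Σ} 𝕋 {θ} {γ} where
  here  : {t t′ : Tm Σ θ γ} {ts : Sub Σ θ γ δ} →
          𝕋 ∣ t ⟶ t′ → 𝕋 ∣ (t ∷ ts) ⟶ˢ (t′ ∷ ts)
  there : {t : Tm Σ θ γ} {ts ts′ : Sub Σ θ γ δ} →
          𝕋 ∣ ts ⟶ˢ ts′ → 𝕋 ∣ (t ∷ ts) ⟶ˢ (t ∷ ts′)

data _∣_⟶ᵐ_ {Σ} 𝕋 {θ} {γ} where
  here  : {t t′ : Tm Σ θ (δ + γ)} {𝐭 : MSub Σ θ γ ξ} →
          𝕋 ∣ t ⟶ t′ → 𝕋 ∣ _∷_ {x = δ} t 𝐭 ⟶ᵐ (t′ ∷ 𝐭)
  there : {t : Tm Σ θ (δ + γ)} {𝐭 𝐭′ : MSub Σ θ γ ξ} →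
          𝕋 ∣ 𝐭 ⟶ᵐ 𝐭′ → 𝕋 ∣ _∷_ {x = δ} t 𝐭 ⟶ᵐ (t ∷ 𝐭′)

_∣_≈_ : Theory Σ → Tm Σ θ γ → Tm Σ θ γ → Set
𝕋 ∣ t ≈ u = EqClosure (𝕋 ∣_⟶_) t u

------------------------------------------------------------------------
-- Declarative typing

typeOf : Ctx Σ θ γ → Fin γ → Tm Σ θ γ
typeOf (Γ ▹ T) zero    = ren suc T
typeOf (Γ ▹ T) (suc x) = ren suc (typeOf Γ x)

entryOf : MCtx Σ θ → δ ∈ θ → Ctx Σ θ δ × Tm Σ θ δ
entryOf (Θ ▹ Γ ⦂ T) (here refl) = wkᵗ id there Γ , wk id there id T
entryOf (Θ ▹ Γ ⦂ T) (there x)   =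
  let Δ , U = entryOf Θ x in wkᵗ id there Δ , wk id there id U

infix 4 _sort _∶_ _∶ˢ_ _∶ᵐ_

data Jdg (Σ : Sig) (θ : MScope) (γ : Scope) : Set where
  wf    : Jdg Σ θ γ
  _sort : Tm Σ θ γ → Jdg Σ θ γ
  _∶_   : Tm Σ θ γ → Tm Σ θ γ → Jdg Σ θ γ
  _∶ˢ_  : Sub Σ θ γ δ → Ctx Σ θ δ → Jdg Σ θ γ
  _∶ᵐ_  : MSub Σ θ γ ξ → MCtx Σ ξ → Jdg Σ θ γ

infix 3 _∣_ok _∣_⨟_⊢_

data _∣_ok (𝕋 : Theory Σ) : MCtx Σ θ → Set
data _∣_⨟_⊢_ (𝕋 : Theory Σ) (Θ : MCtx Σ θ) : Ctx Σ θ γ → Jdg Σ θ γ → Set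

data _∣_ok {Σ} 𝕋 where
  ε : 𝕋 ∣ ε ok

  _▹_ : (Θ : MCtx Σ θ) {Γ : Ctx Σ θ γ} {T : Tm Σ θ γ} →
        𝕋 ∣ Θ ⨟ Γ ⊢ T sort →
        𝕋 ∣ (Θ ▹ Γ ⦂ T) ok

data _∣_⨟_⊢_ {Σ} {θ} 𝕋 Θ where
  ctx-ε : 𝕋 ∣ Θ ok →
          𝕋 ∣ Θ ⨟ ε ⊢ wf

  ctx-▹ : {Γ : Ctx Σ θ γ} {T : Tm Σ θ γ} →
          𝕋 ∣ Θ ⨟ Γ ⊢ T sort →
          𝕋 ∣ Θ ⨟ Γ ▹ T ⊢ wf

  ty-sort : {Γ : Ctx Σ θ γ} {c : con ξ ∈ Σ} {Ξ : MCtx Σ ξ} {𝐭 : MSub Σ θ γ ξ} →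
            sortᴿ c Ξ ∈ rules 𝕋 →
            𝕋 ∣ Θ ⨟ Γ ⊢ 𝐭 ∶ᵐ Ξ →
            𝕋 ∣ Θ ⨟ Γ ⊢ op c 𝐭 sort

  ty-var : {Γ : Ctx Σ θ γ} (x : Fin γ) →
           𝕋 ∣ Θ ⨟ Γ ⊢ wf →
           𝕋 ∣ Θ ⨟ Γ ⊢ var x ∶ typeOf Γ x

  ty-mvar : {Γ : Ctx Σ θ γ} (x : δ ∈ θ) {ts : Sub Σ θ γ δ} →
            𝕋 ∣ Θ ⨟ Γ ⊢ ts ∶ˢ proj₁ (entryOf Θ x) →
            𝕋 ∣ Θ ⨟ Γ ⊢ mvar x ts ∶ proj₂ (entryOf Θ x) [ ts ]

  ty-cons : {Γ : Ctx Σ θ γ} {c : con θc ∈ Σ} {R : ConsRule Σ θp θc θi} →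
            (let open ConsRule R) →
            {𝐭p : MSub Σ θ γ θp} {𝐭 : MSub Σ θ γ θc} →
            consᴿ c R ∈ rules 𝕋 →
            𝕋 ∣ Θ ⨟ Γ ⊢ 𝐭p ⨾ 𝐭 ∶ᵐ Ξp ▹▹ᵐ Ξc →
            𝕋 ∣ Θ ⨟ Γ ⊢ ⌜ T ⌝ ⟦ 𝐭p ⨾ 𝐯i ⟦ 𝐭p ⨾ 𝐭 ⟧ᵐ ⟧ sort →
            𝕋 ∣ Θ ⨟ Γ ⊢ op c 𝐭 ∶ ⌜ T ⌝ ⟦ 𝐭p ⨾ 𝐯i ⟦ 𝐭p ⨾ 𝐭 ⟧ᵐ ⟧

  -- The argument list of d is u , 𝐭, with u the principal argument.
  ty-dest : {Γ : Ctx Σ θ γ} {d : des (θd ++ 0 ∷ []) ∈ Σ} {R : DestRule Σ θp θd} →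
            (let open DestRule R) →
            {𝐭p : MSub Σ θ γ θp} {u : Tm Σ θ γ} {𝐭 : MSub Σ θ γ θd} →
            destᴿ d R ∈ rules 𝕋 →
            𝕋 ∣ Θ ⨟ Γ ⊢ (u ∷ 𝐭p) ⨾ 𝐭 ∶ᵐ (Ξp ▹ ε ⦂ ⌜ T ⌝) ▹▹ᵐ Ξd →
            𝕋 ∣ Θ ⨟ Γ ⊢ op d ((u ∷ []) ⨾ 𝐭) ∶ U ⟦ (u ∷ 𝐭p) ⨾ 𝐭 ⟧

  ty-conv : {Γ : Ctx Σ θ γ} {t T U : Tm Σ θ γ} →
            𝕋 ∣ Θ ⨟ Γ ⊢ t ∶ T →
            𝕋 ∣ T ≈ U →
            𝕋 ∣ Θ ⨟ Γ ⊢ U sort →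
            𝕋 ∣ Θ ⨟ Γ ⊢ t ∶ U

  sub-[] : {Γ : Ctx Σ θ γ} →
           𝕋 ∣ Θ ⨟ Γ ⊢ wf →
           𝕋 ∣ Θ ⨟ Γ ⊢ [] ∶ˢ ε

  sub-∷ : {Γ : Ctx Σ θ γ} {Δ : Ctx Σ θ δ} {T : Tm Σ θ δ} {ts : Sub Σ θ γ δ} {t : Tm Σ θ γ} →
          𝕋 ∣ Θ ⨟ Γ ⊢ ts ∶ˢ Δ →
          𝕋 ∣ Θ ⨟ Γ ⊢ t ∶ T [ ts ] →
          𝕋 ∣ Θ ⨟ Γ ⊢ (t ∷ ts) ∶ˢ (Δ ▹ T)

  msub-[] : {Γ : Ctx Σ θ γ} →
            𝕋 ∣ Θ ⨟ Γ ⊢ wf →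
            𝕋 ∣ Θ ⨟ Γ ⊢ [] ∶ᵐ ε

  msub-∷ : {Γ : Ctx Σ θ γ} {Ξ : MCtx Σ ξ} {Δ : Ctx Σ ξ δ} {T : Tm Σ ξ δ}
           {𝐭 : MSub Σ θ γ ξ} {t : Tm Σ θ (δ + γ)} →
           𝕋 ∣ Θ ⨟ Γ ⊢ 𝐭 ∶ᵐ Ξ →
           𝕋 ∣ Θ ⨟ Γ ▹▹ Δ ⟦ 𝐭 ⟧ᵗ ⊢ t ∶ T ⟦ 𝐭 ⟧ →
           𝕋 ∣ Θ ⨟ Γ ⊢ (t ∷ 𝐭) ∶ᵐ (Ξ ▹ Δ ⦂ T)

------------------------------------------------------------------------
-- Substitution in judgments

_[_]ʲ : Jdg Σ θ γ₂ → Sub Σ θ γ₁ γ₂ → Jdg Σ θ γ₁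
wf        [ vs ]ʲ = wf
(T sort)  [ vs ]ʲ = T [ vs ] sort
(t ∶ T)   [ vs ]ʲ = t [ vs ] ∶ T [ vs ]
(ts ∶ˢ Δ) [ vs ]ʲ = ts [ vs ]ˢ ∶ˢ Δ
(𝐭 ∶ᵐ Ξ)  [ vs ]ʲ = 𝐭 [ vs ]ᵐ ∶ᵐ Ξ

-- In the fourth case tabulate (var ∘ (δ ↑ʳ_)) is id_|Γ| weakened to |Γ|.δ.

_⟦_⟧ʲ_ : Jdg Σ θ₂ δ → MSub Σ θ₁ γ θ₂ → Ctx Σ θ₁ γ → Jdg Σ θ₁ (δ + γ)
wf        ⟦ 𝐯 ⟧ʲ Γ = wf
(T sort)  ⟦ 𝐯 ⟧ʲ Γ = T ⟦ 𝐯 ⟧ sort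
(t ∶ T)   ⟦ 𝐯 ⟧ʲ Γ = t ⟦ 𝐯 ⟧ ∶ T ⟦ 𝐯 ⟧
_⟦_⟧ʲ_ {δ = δ} (ts ∶ˢ Δ) 𝐯 Γ =
  (ts ⟦ 𝐯 ⟧ˢ ++ⱽ tabulate (var ∘ (δ ↑ʳ_))) ∶ˢ (Γ ▹▹ Δ ⟦ 𝐯 ⟧ᵗ)
(𝐭 ∶ᵐ Ξ)  ⟦ 𝐯 ⟧ʲ Γ = 𝐭 ⟦ 𝐯 ⟧ᵐ ∶ᵐ Ξ

{-# OPTIONS --safe #-}
-- Both parts go by induction on the derivation of 𝒥, for a class of substitutions
-- that is closed under binders by construction rather than for typed ones.  The
-- extended target context is then never assumed to be well formed: every leaf of
-- a derivation carries the well-formedness of its own context, and the induction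
-- hypothesis transports it.  Part 1 for the class of weakenings comes first, since
-- looking up a lifted substitution weakens its entries; part 1 in turn handles the
-- metavariable case of part 2, where 𝐯ₓ is instantiated by the translated arguments.

module Submission where

open import Defs
open import Data.Fin using (Fin; zero; suc; lift; _↑ˡ_; _↑ʳ_)
open import Data.List.Membership.Propositional using (_∈_)
open import Data.List.Relation.Binary.Subset.Propositional using (_⊆_)
open import Data.List.Relation.Unary.All using ([]; _∷_) renaming (lookup to lookupᴬ)
open import Data.List.Relation.Unary.Any using (here; there)
open import Data.Nat using (ℕ; zero; suc; _+_)
open import Data.Product using (_×_; _,_; proj₁; proj₂; ∃)
open import Data.Vec using (Vec; []; _∷_; lookup; tabulate) renaming (map to mapⱽ; _++_ to _++ⱽ_)
open import Data.Vec.Properties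
  using (lookup-++ˡ; lookup-++ʳ; lookup∘tabulate; tabulate∘lookup; tabulate-cong; lookup-map)
open import Function using (id; _∘_)
import Relation.Binary.Construct.Closure.Equivalence as Eq
open Eq using (EqClosure)
open import Relation.Binary.PropositionalEquality
  using (_≡_; _≗_; refl; sym; trans; cong; cong₂; subst; subst₂; module ≡-Reasoning)
open ≡-Reasoning

-- The identity on `Γ` in the fourth form of part (2) is what makes the metavariable case go
-- through: the entry of `𝐯` at `x` is typed in `Γ` extended by the instantiated context of `x`, so
-- the translated arguments alone would not form a substitution for that context. Besides typing,
-- the weight lies in `ty-cons`, `ty-dest` and `ty-conv`. The types they assign are instances of
-- rule types under a metavariable substitution, so `_[_]` and `msub` must both commute with `_⟦_⟧`,
-- and conversion must be stable under both. This accounts for the equational theory that precedes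
-- any typing.

private variable
  γ₃ κ′ κ₀ κ₁ δ′ : Scope
  n : ℕ

-- Scopes and vectors

-- Splits a variable so that the goals contain `i ↑ˡ γ` and `δ ↑ʳ j` literally, the forms on which
-- lookups in `↑ˢ` and in appended vectors compute.
↑-elim : ∀ δ (P : Fin (δ + γ) → Set) →
         (∀ i → P (i ↑ˡ γ)) → (∀ j → P (δ ↑ʳ j)) → ∀ k → P k
↑-elim zero    P l r k       = r k
↑-elim (suc δ) P l r zero    = l zero
↑-elim (suc δ) P l r (suc k) = ↑-elim δ (P ∘ suc) (l ∘ suc) r k

lift-↑ˡ : ∀ δ (r : Fin γ → Fin γ′) (i : Fin δ) → lift δ r (i ↑ˡ γ) ≡ i ↑ˡ γ′
lift-↑ˡ (suc δ) r zero    = refl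
lift-↑ˡ (suc δ) r (suc i) = cong suc (lift-↑ˡ δ r i)

lift-↑ʳ : ∀ δ (r : Fin γ → Fin γ′) (j : Fin γ) → lift δ r (δ ↑ʳ j) ≡ δ ↑ʳ r j
lift-↑ʳ zero    r j = refl
lift-↑ʳ (suc δ) r j = cong suc (lift-↑ʳ δ r j)

lift-∘ : ∀ δ {r : Fin γ₁ → Fin γ₂} {r′ : Fin γ₂ → Fin γ₃} {r″ : Fin γ₁ → Fin γ₃} →
         r′ ∘ r ≗ r″ → lift δ r′ ∘ lift δ r ≗ lift δ r″
lift-∘ zero    e i       = e i
lift-∘ (suc δ) e zero    = refl
lift-∘ (suc δ) e (suc i) = cong suc (lift-∘ δ e i)

lookup-ext : {A : Set} {v w : Vec A n} → lookup v ≗ lookup w → v ≡ w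
lookup-ext {v = v} {w} e =
  trans (sym (tabulate∘lookup v)) (trans (tabulate-cong e) (tabulate∘lookup w))

lookup-↑ˢ-↑ˡ : ∀ δ (vs : Sub Σ θ γ₁ γ₂) i → lookup (↑ˢ δ vs) (i ↑ˡ γ₂) ≡ var (i ↑ˡ γ₁)
lookup-↑ˢ-↑ˡ δ vs i = trans (lookup-++ˡ (tabulate _) _ i) (lookup∘tabulate _ i)

lookup-↑ˢ-↑ʳ : ∀ δ (vs : Sub Σ θ γ₁ γ₂) j →
               lookup (↑ˢ δ vs) (δ ↑ʳ j) ≡ ren (δ ↑ʳ_) (lookup vs j)
lookup-↑ˢ-↑ʳ {γ₁ = γ₁} δ vs j =
  trans (lookup-++ʳ (tabulate (λ i → var (i ↑ˡ γ₁))) _ j) (lookup-map j _ vs)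

lookup-[]ˢ : (ts : Sub Σ θ γ₂ δ) (vs : Sub Σ θ γ₁ γ₂) (i : Fin δ) →
             lookup (ts [ vs ]ˢ) i ≡ lookup ts i [ vs ]
lookup-[]ˢ (t ∷ ts) vs zero    = refl
lookup-[]ˢ (t ∷ ts) vs (suc i) = lookup-[]ˢ ts vs i

lookup-[]ᵐ : (𝐭 : MSub Σ θ γ₂ ξ) (vs : Sub Σ θ γ₁ γ₂) (x : δ ∈ ξ) →
             lookupᴬ (𝐭 [ vs ]ᵐ) x ≡ lookupᴬ 𝐭 x [ ↑ˢ δ vs ]
lookup-[]ᵐ (t ∷ 𝐭) vs (here refl) = refl
lookup-[]ᵐ (t ∷ 𝐭) vs (there x)   = lookup-[]ᵐ 𝐭 vs x

lookup-msubˢ : (𝐯 : MSub Σ θ₁ δ θ₂) (ρ : Fin δ → Fin κ) (σ : Fin γ → Fin κ)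
               (ts : Sub Σ θ₂ γ γ′) (i : Fin γ′) →
               lookup (msubˢ 𝐯 ρ σ ts) i ≡ msub 𝐯 ρ σ (lookup ts i)
lookup-msubˢ 𝐯 ρ σ (t ∷ ts) zero    = refl
lookup-msubˢ 𝐯 ρ σ (t ∷ ts) (suc i) = lookup-msubˢ 𝐯 ρ σ ts i

lookup-msubᵐ : (𝐯 : MSub Σ θ₁ δ θ₂) (ρ : Fin δ → Fin κ) (σ : Fin γ → Fin κ)
               (𝐭 : MSub Σ θ₂ γ ξ) (x : δ′ ∈ ξ) →
               lookupᴬ (msubᵐ 𝐯 ρ σ 𝐭) x ≡ msub 𝐯 ((δ′ ↑ʳ_) ∘ ρ) (lift δ′ σ) (lookupᴬ 𝐭 x)
lookup-msubᵐ 𝐯 ρ σ (t ∷ 𝐭) (here refl) = refl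
lookup-msubᵐ 𝐯 ρ σ (t ∷ 𝐭) (there x)   = lookup-msubᵐ 𝐯 ρ σ 𝐭 x

⨾-[] : (𝐭 : MSub Σ θ γ₂ θ₁) (𝐮 : MSub Σ θ γ₂ θ₂) (vs : Sub Σ θ γ₁ γ₂) →
       (𝐭 ⨾ 𝐮) [ vs ]ᵐ ≡ 𝐭 [ vs ]ᵐ ⨾ 𝐮 [ vs ]ᵐ
⨾-[] 𝐭 []      vs = refl
⨾-[] 𝐭 (u ∷ 𝐮) vs = cong (_ ∷_) (⨾-[] 𝐭 𝐮 vs)

⨾-msub : (𝐯 : MSub Σ θ₁ δ θ) (ρ : Fin δ → Fin κ) (σ : Fin γ → Fin κ)
         (𝐭 : MSub Σ θ γ ξ) (𝐮 : MSub Σ θ γ θ₂) →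
         msubᵐ 𝐯 ρ σ (𝐭 ⨾ 𝐮) ≡ msubᵐ 𝐯 ρ σ 𝐭 ⨾ msubᵐ 𝐯 ρ σ 𝐮
⨾-msub 𝐯 ρ σ 𝐭 []      = refl
⨾-msub 𝐯 ρ σ 𝐭 (u ∷ 𝐮) = cong (_ ∷_) (⨾-msub 𝐯 ρ σ 𝐭 𝐮)

-- Renaming and substitution.  Without function extensionality a composite is
-- described by a pointwise hypothesis that survives the passage under binders.

ren-ren  : {r : Fin γ₁ → Fin γ₂} {r′ : Fin γ₂ → Fin γ₃} {r″ : Fin γ₁ → Fin γ₃} →
           r′ ∘ r ≗ r″ → (t : Tm Σ θ γ₁) → ren r′ (ren r t) ≡ ren r″ t
ren-renˢ : {r : Fin γ₁ → Fin γ₂} {r′ : Fin γ₂ → Fin γ₃} {r″ : Fin γ₁ → Fin γ₃} →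
           r′ ∘ r ≗ r″ → (ts : Sub Σ θ γ₁ δ) →
           wkˢ id id r′ (wkˢ id id r ts) ≡ wkˢ id id r″ ts
ren-renᵐ : {r : Fin γ₁ → Fin γ₂} {r′ : Fin γ₂ → Fin γ₃} {r″ : Fin γ₁ → Fin γ₃} →
           r′ ∘ r ≗ r″ → (𝐭 : MSub Σ θ γ₁ ξ) →
           wkᵐ id id r′ (wkᵐ id id r 𝐭) ≡ wkᵐ id id r″ 𝐭
ren-ren e (var x)     = cong var (e x)
ren-ren e (mvar x ts) = cong (mvar x) (ren-renˢ e ts)
ren-ren e (op o 𝐭)    = cong (op o) (ren-renᵐ e 𝐭)
ren-renˢ e []       = refl
ren-renˢ e (t ∷ ts) = cong₂ _∷_ (ren-ren e t) (ren-renˢ e ts)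
ren-renᵐ e []                = refl
ren-renᵐ e (_∷_ {x = δ} t 𝐭) = cong₂ _∷_ (ren-ren (lift-∘ δ e) t) (ren-renᵐ e 𝐭)

↑ˢ-ren : ∀ δ {r : Fin γ₁ → Fin γ₂} {vs : Sub Σ θ γ γ₂} {ws : Sub Σ θ γ γ₁} →
         lookup vs ∘ r ≗ lookup ws → lookup (↑ˢ δ vs) ∘ lift δ r ≗ lookup (↑ˢ δ ws)
↑ˢ-ren δ {r} {vs} {ws} e = ↑-elim δ _
  (λ i → trans (cong (lookup (↑ˢ δ vs)) (lift-↑ˡ δ r i))
           (trans (lookup-↑ˢ-↑ˡ δ vs i) (sym (lookup-↑ˢ-↑ˡ δ ws i))))
  (λ j → trans (cong (lookup (↑ˢ δ vs)) (lift-↑ʳ δ r j))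
           (trans (lookup-↑ˢ-↑ʳ δ vs (r j))
             (trans (cong (ren (δ ↑ʳ_)) (e j)) (sym (lookup-↑ˢ-↑ʳ δ ws j)))))

ren-[]  : {r : Fin γ₁ → Fin γ₂} {vs : Sub Σ θ γ γ₂} {ws : Sub Σ θ γ γ₁} →
          lookup vs ∘ r ≗ lookup ws → (t : Tm Σ θ γ₁) → ren r t [ vs ] ≡ t [ ws ]
ren-[]ˢ : {r : Fin γ₁ → Fin γ₂} {vs : Sub Σ θ γ γ₂} {ws : Sub Σ θ γ γ₁} →
          lookup vs ∘ r ≗ lookup ws → (ts : Sub Σ θ γ₁ δ) →
          wkˢ id id r ts [ vs ]ˢ ≡ ts [ ws ]ˢ
ren-[]ᵐ : {r : Fin γ₁ → Fin γ₂} {vs : Sub Σ θ γ γ₂} {ws : Sub Σ θ γ γ₁} →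
          lookup vs ∘ r ≗ lookup ws → (𝐭 : MSub Σ θ γ₁ ξ) →
          wkᵐ id id r 𝐭 [ vs ]ᵐ ≡ 𝐭 [ ws ]ᵐ
ren-[] e (var x)     = e x
ren-[] e (mvar x ts) = cong (mvar x) (ren-[]ˢ e ts)
ren-[] e (op o 𝐭)    = cong (op o) (ren-[]ᵐ e 𝐭)
ren-[]ˢ e []       = refl
ren-[]ˢ e (t ∷ ts) = cong₂ _∷_ (ren-[] e t) (ren-[]ˢ e ts)
ren-[]ᵐ e []                = refl
ren-[]ᵐ {vs = vs} {ws} e (_∷_ {x = δ} t 𝐭) =
  cong₂ _∷_ (ren-[] (↑ˢ-ren δ {vs = vs} {ws} e) t) (ren-[]ᵐ e 𝐭)

ren-↑ˢ : ∀ δ {r : Fin γ₁ → Fin γ₂} {vs : Sub Σ θ γ₁ γ} {ws : Sub Σ θ γ₂ γ} →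
         ren r ∘ lookup vs ≗ lookup ws → ren (lift δ r) ∘ lookup (↑ˢ δ vs) ≗ lookup (↑ˢ δ ws)
ren-↑ˢ δ {r} {vs} {ws} e = ↑-elim δ _
  (λ i → trans (cong (ren (lift δ r)) (lookup-↑ˢ-↑ˡ δ vs i))
           (trans (cong var (lift-↑ˡ δ r i)) (sym (lookup-↑ˢ-↑ˡ δ ws i))))
  (λ j → begin
    ren (lift δ r) (lookup (↑ˢ δ vs) (δ ↑ʳ j))
      ≡⟨ cong (ren (lift δ r)) (lookup-↑ˢ-↑ʳ δ vs j) ⟩
    ren (lift δ r) (ren (δ ↑ʳ_) (lookup vs j))
      ≡⟨ ren-ren (lift-↑ʳ δ r) (lookup vs j) ⟩
    ren (λ i → δ ↑ʳ r i) (lookup vs j)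
      ≡⟨ ren-ren (λ _ → refl) (lookup vs j) ⟨
    ren (δ ↑ʳ_) (ren r (lookup vs j))
      ≡⟨ cong (ren (δ ↑ʳ_)) (e j) ⟩
    ren (δ ↑ʳ_) (lookup ws j)
      ≡⟨ lookup-↑ˢ-↑ʳ δ ws j ⟨
    lookup (↑ˢ δ ws) (δ ↑ʳ j) ∎)

[]-ren  : {r : Fin γ₁ → Fin γ₂} {vs : Sub Σ θ γ₁ γ} {ws : Sub Σ θ γ₂ γ} →
          ren r ∘ lookup vs ≗ lookup ws → (t : Tm Σ θ γ) → ren r (t [ vs ]) ≡ t [ ws ]
[]-renˢ : {r : Fin γ₁ → Fin γ₂} {vs : Sub Σ θ γ₁ γ} {ws : Sub Σ θ γ₂ γ} →
          ren r ∘ lookup vs ≗ lookup ws → (ts : Sub Σ θ γ δ) →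
          wkˢ id id r (ts [ vs ]ˢ) ≡ ts [ ws ]ˢ
[]-renᵐ : {r : Fin γ₁ → Fin γ₂} {vs : Sub Σ θ γ₁ γ} {ws : Sub Σ θ γ₂ γ} →
          ren r ∘ lookup vs ≗ lookup ws → (𝐭 : MSub Σ θ γ ξ) →
          wkᵐ id id r (𝐭 [ vs ]ᵐ) ≡ 𝐭 [ ws ]ᵐ
[]-ren e (var x)     = e x
[]-ren e (mvar x ts) = cong (mvar x) ([]-renˢ e ts)
[]-ren e (op o 𝐭)    = cong (op o) ([]-renᵐ e 𝐭)
[]-renˢ e []       = refl
[]-renˢ e (t ∷ ts) = cong₂ _∷_ ([]-ren e t) ([]-renˢ e ts)
[]-renᵐ e []                = refl
[]-renᵐ {vs = vs} {ws} e (_∷_ {x = δ} t 𝐭) =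
  cong₂ _∷_ ([]-ren (ren-↑ˢ δ {vs = vs} {ws} e) t) ([]-renᵐ e 𝐭)

-- Both sides are `t` under the list of weakened entries of `vs`.
ren-↑ʳ-[↑ˢ] : ∀ δ (vs : Sub Σ θ γ₁ γ₂) (t : Tm Σ θ γ₂) →
              ren (δ ↑ʳ_) t [ ↑ˢ δ vs ] ≡ ren (δ ↑ʳ_) (t [ vs ])
ren-↑ʳ-[↑ˢ] δ vs t =
  trans (ren-[] {ws = mapⱽ (ren (δ ↑ʳ_)) vs}
          (λ j → trans (lookup-↑ˢ-↑ʳ δ vs j) (sym (lookup-map j _ vs))) t)
        (sym ([]-ren (λ j → sym (lookup-map j (ren (δ ↑ʳ_)) vs)) t))

↑ˢ-[] : ∀ δ {vs : Sub Σ θ γ₂ γ} {ws : Sub Σ θ γ₁ γ₂} {us : Sub Σ θ γ₁ γ} →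
        (∀ i → lookup vs i [ ws ] ≡ lookup us i) →
        ∀ i → lookup (↑ˢ δ vs) i [ ↑ˢ δ ws ] ≡ lookup (↑ˢ δ us) i
↑ˢ-[] δ {vs} {ws} {us} e = ↑-elim δ _
  (λ i → trans (cong (_[ ↑ˢ δ ws ]) (lookup-↑ˢ-↑ˡ δ vs i))
           (trans (lookup-↑ˢ-↑ˡ δ ws i) (sym (lookup-↑ˢ-↑ˡ δ us i))))
  (λ j → begin
    lookup (↑ˢ δ vs) (δ ↑ʳ j) [ ↑ˢ δ ws ]      ≡⟨ cong (_[ ↑ˢ δ ws ]) (lookup-↑ˢ-↑ʳ δ vs j) ⟩
    ren (δ ↑ʳ_) (lookup vs j) [ ↑ˢ δ ws ]      ≡⟨ ren-↑ʳ-[↑ˢ] δ ws (lookup vs j) ⟩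
    ren (δ ↑ʳ_) (lookup vs j [ ws ])           ≡⟨ cong (ren (δ ↑ʳ_)) (e j) ⟩
    ren (δ ↑ʳ_) (lookup us j)                  ≡⟨ lookup-↑ˢ-↑ʳ δ us j ⟨
    lookup (↑ˢ δ us) (δ ↑ʳ j)                  ∎)

-- Under a binder the entries of `vs` are weakened before `↑ˢ δ ws` acts on them, so `ren-[]` and
-- `[]-ren` have to come first; they enter through `ren-↑ʳ-[↑ˢ]`.
[]-[]  : {vs : Sub Σ θ γ₂ γ} {ws : Sub Σ θ γ₁ γ₂} {us : Sub Σ θ γ₁ γ} →
         (∀ i → lookup vs i [ ws ] ≡ lookup us i) →
         (t : Tm Σ θ γ) → t [ vs ] [ ws ] ≡ t [ us ]
[]-[]ˢ : {vs : Sub Σ θ γ₂ γ} {ws : Sub Σ θ γ₁ γ₂} {us : Sub Σ θ γ₁ γ} →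
         (∀ i → lookup vs i [ ws ] ≡ lookup us i) →
         (ts : Sub Σ θ γ δ) → ts [ vs ]ˢ [ ws ]ˢ ≡ ts [ us ]ˢ
[]-[]ᵐ : {vs : Sub Σ θ γ₂ γ} {ws : Sub Σ θ γ₁ γ₂} {us : Sub Σ θ γ₁ γ} →
         (∀ i → lookup vs i [ ws ] ≡ lookup us i) →
         (𝐭 : MSub Σ θ γ ξ) → 𝐭 [ vs ]ᵐ [ ws ]ᵐ ≡ 𝐭 [ us ]ᵐ
[]-[] e (var x)     = e x
[]-[] e (mvar x ts) = cong (mvar x) ([]-[]ˢ e ts)
[]-[] e (op o 𝐭)    = cong (op o) ([]-[]ᵐ e 𝐭)
[]-[]ˢ e []       = refl
[]-[]ˢ e (t ∷ ts) = cong₂ _∷_ ([]-[] e t) ([]-[]ˢ e ts)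
[]-[]ᵐ e []                = refl
[]-[]ᵐ {vs = vs} {ws} {us} e (_∷_ {x = δ} t 𝐭) =
  cong₂ _∷_ ([]-[] (↑ˢ-[] δ {vs} {ws} {us} e) t) ([]-[]ᵐ e 𝐭)

-- Substitutions by variables, identities, and lifting one variable at a time

↑ˢ-var : ∀ δ {r : Fin γ₂ → Fin γ₁} {vs : Sub Σ θ γ₁ γ₂} →
         lookup vs ≗ var ∘ r → lookup (↑ˢ δ vs) ≗ var ∘ lift δ r
↑ˢ-var δ {r} {vs} e = ↑-elim δ _
  (λ i → trans (lookup-↑ˢ-↑ˡ δ vs i) (cong var (sym (lift-↑ˡ δ r i))))
  (λ j → trans (lookup-↑ˢ-↑ʳ δ vs j)
           (trans (cong (ren (δ ↑ʳ_)) (e j)) (cong var (sym (lift-↑ʳ δ r j)))))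

-- Makes renaming an instance of substitution, so that later facts about renaming (`ren-msub`,
-- `≈-ren`, `⊢-ren-suc`) follow from those about substitution without a second induction.
[var]  : {r : Fin γ₂ → Fin γ₁} {vs : Sub Σ θ γ₁ γ₂} → lookup vs ≗ var ∘ r →
         (t : Tm Σ θ γ₂) → t [ vs ] ≡ ren r t
[var]ˢ : {r : Fin γ₂ → Fin γ₁} {vs : Sub Σ θ γ₁ γ₂} → lookup vs ≗ var ∘ r →
         (ts : Sub Σ θ γ₂ δ) → ts [ vs ]ˢ ≡ wkˢ id id r ts
[var]ᵐ : {r : Fin γ₂ → Fin γ₁} {vs : Sub Σ θ γ₁ γ₂} → lookup vs ≗ var ∘ r →
         (𝐭 : MSub Σ θ γ₂ ξ) → 𝐭 [ vs ]ᵐ ≡ wkᵐ id id r 𝐭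
[var] e (var x)     = e x
[var] e (mvar x ts) = cong (mvar x) ([var]ˢ e ts)
[var] e (op o 𝐭)    = cong (op o) ([var]ᵐ e 𝐭)
[var]ˢ e []       = refl
[var]ˢ e (t ∷ ts) = cong₂ _∷_ ([var] e t) ([var]ˢ e ts)
[var]ᵐ e []                = refl
[var]ᵐ {vs = vs} e (_∷_ {x = δ} t 𝐭) = cong₂ _∷_ ([var] (↑ˢ-var δ {vs = vs} e) t) ([var]ᵐ e 𝐭)

[tabulate-var] : (r : Fin γ₂ → Fin γ₁) (t : Tm Σ θ γ₂) → t [ tabulate (var ∘ r) ] ≡ ren r t
[tabulate-var] r = [var] (lookup∘tabulate (var ∘ r))

lift-id : ∀ δ {r : Fin γ → Fin γ} → r ≗ id → lift δ r ≗ id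
lift-id zero    e i       = e i
lift-id (suc δ) e zero    = refl
lift-id (suc δ) e (suc i) = cong suc (lift-id δ e i)

ren-id  : {r : Fin γ → Fin γ} → r ≗ id → (t : Tm Σ θ γ) → ren r t ≡ t
ren-idˢ : {r : Fin γ → Fin γ} → r ≗ id → (ts : Sub Σ θ γ δ) → wkˢ id id r ts ≡ ts
ren-idᵐ : {r : Fin γ → Fin γ} → r ≗ id → (𝐭 : MSub Σ θ γ ξ) → wkᵐ id id r 𝐭 ≡ 𝐭
ren-id e (var x)     = cong var (e x)
ren-id e (mvar x ts) = cong (mvar x) (ren-idˢ e ts)
ren-id e (op o 𝐭)    = cong (op o) (ren-idᵐ e 𝐭)
ren-idˢ e []       = refl
ren-idˢ e (t ∷ ts) = cong₂ _∷_ (ren-id e t) (ren-idˢ e ts)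
ren-idᵐ e []                = refl
ren-idᵐ e (_∷_ {x = δ} t 𝐭) = cong₂ _∷_ (ren-id (lift-id δ e) t) (ren-idᵐ e 𝐭)

-- Together with `↑ˢ-suc` this reduces lifting over a whole context to single binders. The equation
-- is only propositional, since `↑ˢ 0` still renames every entry by the identity.
↑ˢ-zero : (vs : Sub Σ θ γ₁ γ₂) → ↑ˢ 0 vs ≡ vs
↑ˢ-zero vs = lookup-ext λ i → trans (lookup-map i _ vs) (ren-id (λ _ → refl) (lookup vs i))

↑ˢ-suc : ∀ δ (vs : Sub Σ θ γ₁ γ₂) → ↑ˢ (suc δ) vs ≡ ↑ˢ 1 (↑ˢ δ vs)
↑ˢ-suc {γ₁ = γ₁} δ vs = lookup-ext λ
  { zero    → refl
  ; (suc k) → ↑-elim δ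
      (λ k → lookup (↑ˢ (suc δ) vs) (suc k) ≡ lookup (mapⱽ (ren suc) (↑ˢ δ vs)) k)
      (λ i → trans (lookup-↑ˢ-↑ˡ (suc δ) vs (suc i))
               (sym (trans (lookup-map (i ↑ˡ _) (ren suc) (↑ˢ δ vs))
                      (cong (ren suc) (lookup-↑ˢ-↑ˡ δ vs i)))))
      (λ j → trans (lookup-↑ˢ-↑ʳ (suc δ) vs j)
               (sym (trans (lookup-map (δ ↑ʳ j) (ren suc) (↑ˢ δ vs))
                      (trans (cong (ren suc) (lookup-↑ˢ-↑ʳ δ vs j))
                        (ren-ren (λ _ → refl) (lookup vs j))))))
      k }

-- Metavariable substitution

-- The hypotheses say that `ws` merely renames the variables of `t` itself and acts on the scope of
-- `𝐭` as `vs` followed by `ρ′`. At a metavariable both sides become the same entry of `𝐭` under two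
-- composites, which `agree` compares: on arguments by induction, on the scope of `𝐭` by the second
-- hypothesis.
msub-then-[]  : {𝐭 : MSub Σ θ γ₂ ξ} {vs : Sub Σ θ γ₁ γ₂} {ws : Sub Σ θ κ′ κ}
           {ρ : Fin γ₂ → Fin κ} {ρ′ : Fin γ₁ → Fin κ′} {σ : Fin γ → Fin κ} {σ′ : Fin γ → Fin κ′} →
           lookup ws ∘ σ ≗ var ∘ σ′ → lookup ws ∘ ρ ≗ ren ρ′ ∘ lookup vs →
           (t : Tm Σ ξ γ) → msub 𝐭 ρ σ t [ ws ] ≡ msub (𝐭 [ vs ]ᵐ) ρ′ σ′ t
msub-then-[]ˢ : {𝐭 : MSub Σ θ γ₂ ξ} {vs : Sub Σ θ γ₁ γ₂} {ws : Sub Σ θ κ′ κ}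
           {ρ : Fin γ₂ → Fin κ} {ρ′ : Fin γ₁ → Fin κ′} {σ : Fin γ → Fin κ} {σ′ : Fin γ → Fin κ′} →
           lookup ws ∘ σ ≗ var ∘ σ′ → lookup ws ∘ ρ ≗ ren ρ′ ∘ lookup vs →
           (ts : Sub Σ ξ γ δ) → msubˢ 𝐭 ρ σ ts [ ws ]ˢ ≡ msubˢ (𝐭 [ vs ]ᵐ) ρ′ σ′ ts
msub-then-[]ᵐ : {𝐭 : MSub Σ θ γ₂ ξ} {vs : Sub Σ θ γ₁ γ₂} {ws : Sub Σ θ κ′ κ}
           {ρ : Fin γ₂ → Fin κ} {ρ′ : Fin γ₁ → Fin κ′} {σ : Fin γ → Fin κ} {σ′ : Fin γ → Fin κ′} →
           lookup ws ∘ σ ≗ var ∘ σ′ → lookup ws ∘ ρ ≗ ren ρ′ ∘ lookup vs →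
           (𝐮 : MSub Σ ξ γ θ₂) → msubᵐ 𝐭 ρ σ 𝐮 [ ws ]ᵐ ≡ msubᵐ (𝐭 [ vs ]ᵐ) ρ′ σ′ 𝐮
msub-then-[] e f (var x) = e x
msub-then-[] {𝐭 = 𝐭} {vs} {ws} {ρ} {ρ′} {σ} {σ′} e f (mvar {δ = δ} x ts) = begin
  lookupᴬ 𝐭 x [ msubˢ 𝐭 ρ σ ts ++ⱽ tabulate (var ∘ ρ) ] [ ws ]
    ≡⟨ []-[] agree (lookupᴬ 𝐭 x) ⟩
  lookupᴬ 𝐭 x [ ↑ˢ δ vs [ us ]ˢ ]
    ≡⟨ []-[] (λ i → sym (lookup-[]ˢ (↑ˢ δ vs) us i)) (lookupᴬ 𝐭 x) ⟨
  lookupᴬ 𝐭 x [ ↑ˢ δ vs ] [ us ]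
    ≡⟨ cong (_[ us ]) (lookup-[]ᵐ 𝐭 vs x) ⟨
  lookupᴬ (𝐭 [ vs ]ᵐ) x [ us ] ∎
  where
  us = msubˢ (𝐭 [ vs ]ᵐ) ρ′ σ′ ts ++ⱽ tabulate (var ∘ ρ′)
  ts′ = msubˢ 𝐭 ρ σ ts
  agree : ∀ i → lookup (ts′ ++ⱽ tabulate (var ∘ ρ)) i [ ws ] ≡ lookup (↑ˢ δ vs [ us ]ˢ) i
  agree = ↑-elim δ _
    (λ i → begin
      lookup (ts′ ++ⱽ tabulate (var ∘ ρ)) (i ↑ˡ _) [ ws ]
        ≡⟨ cong (_[ ws ]) (lookup-++ˡ ts′ _ i) ⟩
      lookup ts′ i [ ws ]
        ≡⟨ lookup-[]ˢ ts′ ws i ⟨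
      lookup (ts′ [ ws ]ˢ) i
        ≡⟨ cong (λ z → lookup z i) (msub-then-[]ˢ e f ts) ⟩
      lookup (msubˢ (𝐭 [ vs ]ᵐ) ρ′ σ′ ts) i
        ≡⟨ lookup-++ˡ (msubˢ (𝐭 [ vs ]ᵐ) ρ′ σ′ ts) _ i ⟨
      lookup us (i ↑ˡ _)
        ≡⟨ cong (_[ us ]) (lookup-↑ˢ-↑ˡ δ vs i) ⟨
      lookup (↑ˢ δ vs) (i ↑ˡ _) [ us ]
        ≡⟨ lookup-[]ˢ (↑ˢ δ vs) us (i ↑ˡ _) ⟨
      lookup (↑ˢ δ vs [ us ]ˢ) (i ↑ˡ _) ∎)
    (λ j → begin
      lookup (ts′ ++ⱽ tabulate (var ∘ ρ)) (δ ↑ʳ j) [ ws ]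
        ≡⟨ cong (_[ ws ]) (trans (lookup-++ʳ ts′ _ j) (lookup∘tabulate _ j)) ⟩
      lookup ws (ρ j)
        ≡⟨ f j ⟩
      ren ρ′ (lookup vs j)
        ≡⟨ [tabulate-var] ρ′ (lookup vs j) ⟨
      lookup vs j [ tabulate (var ∘ ρ′) ]
        ≡⟨ ren-[] (lookup-++ʳ (msubˢ (𝐭 [ vs ]ᵐ) ρ′ σ′ ts) _) (lookup vs j) ⟨
      ren (δ ↑ʳ_) (lookup vs j) [ us ]
        ≡⟨ cong (_[ us ]) (lookup-↑ˢ-↑ʳ δ vs j) ⟨
      lookup (↑ˢ δ vs) (δ ↑ʳ j) [ us ]
        ≡⟨ lookup-[]ˢ (↑ˢ δ vs) us (δ ↑ʳ j) ⟨
      lookup (↑ˢ δ vs [ us ]ˢ) (δ ↑ʳ j) ∎)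
msub-then-[] e f (op o 𝐮) = cong (op o) (msub-then-[]ᵐ e f 𝐮)
msub-then-[]ˢ e f []       = refl
msub-then-[]ˢ e f (t ∷ ts) = cong₂ _∷_ (msub-then-[] e f t) (msub-then-[]ˢ e f ts)
msub-then-[]ᵐ e f [] = refl
msub-then-[]ᵐ {vs = vs} {ws} {ρ} {ρ′} {σ} {σ′} e f (_∷_ {x = δ} t 𝐮) =
  cong₂ _∷_
    (msub-then-[]
      (↑-elim δ _
        (λ i → trans (cong (lookup (↑ˢ δ ws)) (lift-↑ˡ δ σ i))
                 (trans (lookup-↑ˢ-↑ˡ δ ws i) (cong var (sym (lift-↑ˡ δ σ′ i)))))
        (λ j → trans (cong (lookup (↑ˢ δ ws)) (lift-↑ʳ δ σ j))
                 (trans (lookup-↑ˢ-↑ʳ δ ws (σ j))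
                   (trans (cong (ren (δ ↑ʳ_)) (e j)) (cong var (sym (lift-↑ʳ δ σ′ j)))))))
      (λ j → trans (lookup-↑ˢ-↑ʳ δ ws (ρ j))
               (trans (cong (ren (δ ↑ʳ_)) (f j)) (ren-ren (λ _ → refl) (lookup vs j))))
      t)
    (msub-then-[]ᵐ e f 𝐮)

⟦⟧-[↑ˢ] : (t : Tm Σ ξ δ) (𝐭 : MSub Σ θ γ₂ ξ) (vs : Sub Σ θ γ₁ γ₂) →
          t ⟦ 𝐭 ⟧ [ ↑ˢ δ vs ] ≡ t ⟦ 𝐭 [ vs ]ᵐ ⟧
⟦⟧-[↑ˢ] {δ = δ} t 𝐭 vs = msub-then-[] (lookup-↑ˢ-↑ˡ δ vs) (lookup-↑ˢ-↑ʳ δ vs) t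

⟦⟧-[] : (t : Tm Σ ξ 0) (𝐭 : MSub Σ θ γ₂ ξ) (vs : Sub Σ θ γ₁ γ₂) →
        t ⟦ 𝐭 ⟧ [ vs ] ≡ t ⟦ 𝐭 [ vs ]ᵐ ⟧
⟦⟧-[] t 𝐭 vs = msub-then-[] (λ ()) (λ j → sym (ren-id (λ _ → refl) (lookup vs j))) t

⟦⟧ᵐ-[]ᵐ : (𝐮 : MSub Σ ξ 0 θ₂) (𝐭 : MSub Σ θ γ₂ ξ) (vs : Sub Σ θ γ₁ γ₂) →
          𝐮 ⟦ 𝐭 ⟧ᵐ [ vs ]ᵐ ≡ 𝐮 ⟦ 𝐭 [ vs ]ᵐ ⟧ᵐ
⟦⟧ᵐ-[]ᵐ 𝐮 𝐭 vs = msub-then-[]ᵐ (λ ()) (λ j → sym (ren-id (λ _ → refl) (lookup vs j))) 𝐮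

-- Serves two purposes: discarding an entry of `𝐯` for a metavariable that `t` cannot mention (`m`
-- is `there`), and absorbing a weakening of variables into `σ` (`m` is the identity).
msub-wk  : {m : θ′ ⊆ θ₂} {𝐯 : MSub Σ θ₁ δ θ₂} {𝐯′ : MSub Σ θ₁ δ θ′} {ρ : Fin δ → Fin κ}
           {r : Fin γ → Fin γ′} {σ : Fin γ′ → Fin κ} {σ′ : Fin γ → Fin κ} →
           (∀ {δ′} (x : δ′ ∈ θ′) → lookupᴬ 𝐯 (m x) ≡ lookupᴬ 𝐯′ x) → σ ∘ r ≗ σ′ →
           (t : Tm Σ θ′ γ) → msub 𝐯 ρ σ (wk id m r t) ≡ msub 𝐯′ ρ σ′ t
msub-wkˢ : {m : θ′ ⊆ θ₂} {𝐯 : MSub Σ θ₁ δ θ₂} {𝐯′ : MSub Σ θ₁ δ θ′} {ρ : Fin δ → Fin κ}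
           {r : Fin γ → Fin γ′} {σ : Fin γ′ → Fin κ} {σ′ : Fin γ → Fin κ} →
           (∀ {δ′} (x : δ′ ∈ θ′) → lookupᴬ 𝐯 (m x) ≡ lookupᴬ 𝐯′ x) → σ ∘ r ≗ σ′ →
           (ts : Sub Σ θ′ γ δ′) → msubˢ 𝐯 ρ σ (wkˢ id m r ts) ≡ msubˢ 𝐯′ ρ σ′ ts
msub-wkᵐ : {m : θ′ ⊆ θ₂} {𝐯 : MSub Σ θ₁ δ θ₂} {𝐯′ : MSub Σ θ₁ δ θ′} {ρ : Fin δ → Fin κ}
           {r : Fin γ → Fin γ′} {σ : Fin γ′ → Fin κ} {σ′ : Fin γ → Fin κ} →
           (∀ {δ′} (x : δ′ ∈ θ′) → lookupᴬ 𝐯 (m x) ≡ lookupᴬ 𝐯′ x) → σ ∘ r ≗ σ′ →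
           (𝐭 : MSub Σ θ′ γ ξ) → msubᵐ 𝐯 ρ σ (wkᵐ id m r 𝐭) ≡ msubᵐ 𝐯′ ρ σ′ 𝐭
msub-wk l e (var x) = cong var (e x)
msub-wk {ρ = ρ} l e (mvar x ts) =
  cong₂ (λ t us → t [ us ++ⱽ tabulate (var ∘ ρ) ]) (l x) (msub-wkˢ l e ts)
msub-wk l e (op o 𝐭) = cong (op o) (msub-wkᵐ l e 𝐭)
msub-wkˢ l e []       = refl
msub-wkˢ l e (t ∷ ts) = cong₂ _∷_ (msub-wk l e t) (msub-wkˢ l e ts)
msub-wkᵐ l e []                = refl
msub-wkᵐ l e (_∷_ {x = δ} t 𝐭) = cong₂ _∷_ (msub-wk l (lift-∘ δ e) t) (msub-wkᵐ l e 𝐭)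

-- An instance of `msub-then-[]`: `r` is read as a substitution by variables, and `vs` is the
-- identity, which leaves `𝐯` unchanged.
ren-msub : {𝐯 : MSub Σ θ₁ δ θ₂} {r : Fin κ → Fin κ′} {ρ : Fin δ → Fin κ} {ρ′ : Fin δ → Fin κ′}
           {σ : Fin γ → Fin κ} {σ′ : Fin γ → Fin κ′} → r ∘ ρ ≗ ρ′ → r ∘ σ ≗ σ′ →
           (t : Tm Σ θ₂ γ) → ren r (msub 𝐯 ρ σ t) ≡ msub 𝐯 ρ′ σ′ t
ren-msub {𝐯 = 𝐯} {r} {ρ} {ρ′} {σ} {σ′} e f t = begin
  ren r (msub 𝐯 ρ σ t)
    ≡⟨ [tabulate-var] r (msub 𝐯 ρ σ t) ⟨
  msub 𝐯 ρ σ t [ tabulate (var ∘ r) ]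
    ≡⟨ msub-then-[]
         (λ i → trans (lookup∘tabulate _ (σ i)) (cong var (f i)))
         (λ j → trans (trans (lookup∘tabulate _ (ρ j)) (cong var (e j)))
                  (cong (ren ρ′) (sym (lookup∘tabulate var j))))
         t ⟩
  msub (𝐯 [ idˢ ]ᵐ) ρ′ σ′ t
    ≡⟨ cong (λ z → msub z ρ′ σ′ t)
         (trans ([var]ᵐ (lookup∘tabulate var) 𝐯) (ren-idᵐ (λ _ → refl) 𝐯)) ⟩
  msub 𝐯 ρ′ σ′ t ∎

-- `ws` sends the variables of `t` to the translated entries of `ts` and those of the scope of `𝐯`
-- to themselves. The latter preserves the trailing identity that `msub` inserts at each
-- metavariable.
msub-after-[]  : {𝐯 : MSub Σ θ₁ δ θ₂} {ρ : Fin δ → Fin κ} {ρ′ : Fin δ → Fin κ′}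
           {σ : Fin γ₁ → Fin κ} {σ′ : Fin γ → Fin κ′}
           {ts : Sub Σ θ₂ γ₁ γ} {ws : Sub Σ θ₁ κ κ′} →
           lookup ws ∘ σ′ ≗ msub 𝐯 ρ σ ∘ lookup ts → lookup ws ∘ ρ′ ≗ var ∘ ρ →
           (t : Tm Σ θ₂ γ) → msub 𝐯 ρ′ σ′ t [ ws ] ≡ msub 𝐯 ρ σ (t [ ts ])
msub-after-[]ˢ : {𝐯 : MSub Σ θ₁ δ θ₂} {ρ : Fin δ → Fin κ} {ρ′ : Fin δ → Fin κ′}
           {σ : Fin γ₁ → Fin κ} {σ′ : Fin γ → Fin κ′}
           {ts : Sub Σ θ₂ γ₁ γ} {ws : Sub Σ θ₁ κ κ′} →
           lookup ws ∘ σ′ ≗ msub 𝐯 ρ σ ∘ lookup ts → lookup ws ∘ ρ′ ≗ var ∘ ρ →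
           (us : Sub Σ θ₂ γ δ′) → msubˢ 𝐯 ρ′ σ′ us [ ws ]ˢ ≡ msubˢ 𝐯 ρ σ (us [ ts ]ˢ)
msub-after-[]ᵐ : {𝐯 : MSub Σ θ₁ δ θ₂} {ρ : Fin δ → Fin κ} {ρ′ : Fin δ → Fin κ′}
           {σ : Fin γ₁ → Fin κ} {σ′ : Fin γ → Fin κ′}
           {ts : Sub Σ θ₂ γ₁ γ} {ws : Sub Σ θ₁ κ κ′} →
           lookup ws ∘ σ′ ≗ msub 𝐯 ρ σ ∘ lookup ts → lookup ws ∘ ρ′ ≗ var ∘ ρ →
           (𝐮 : MSub Σ θ₂ γ ξ) → msubᵐ 𝐯 ρ′ σ′ 𝐮 [ ws ]ᵐ ≡ msubᵐ 𝐯 ρ σ (𝐮 [ ts ]ᵐ)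
msub-after-[] e f (var x) = e x
msub-after-[] {𝐯 = 𝐯} {ρ} {ρ′} {σ} {σ′} {ts} {ws} e f (mvar {δ = δ} x us) =
  []-[] (↑-elim δ _
      (λ i → begin
        lookup (us′ ++ⱽ tabulate (var ∘ ρ′)) (i ↑ˡ _) [ ws ]
          ≡⟨ cong (_[ ws ]) (lookup-++ˡ us′ _ i) ⟩
        lookup us′ i [ ws ]
          ≡⟨ lookup-[]ˢ us′ ws i ⟨
        lookup (us′ [ ws ]ˢ) i
          ≡⟨ cong (λ z → lookup z i) (msub-after-[]ˢ e f us) ⟩
        lookup us″ i
          ≡⟨ lookup-++ˡ us″ _ i ⟨
        lookup (us″ ++ⱽ tabulate (var ∘ ρ)) (i ↑ˡ _) ∎)
      (λ j → begin
        lookup (us′ ++ⱽ tabulate (var ∘ ρ′)) (δ ↑ʳ j) [ ws ]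
          ≡⟨ cong (_[ ws ]) (trans (lookup-++ʳ us′ _ j) (lookup∘tabulate _ j)) ⟩
        lookup ws (ρ′ j)
          ≡⟨ f j ⟩
        var (ρ j)
          ≡⟨ trans (lookup-++ʳ us″ _ j) (lookup∘tabulate _ j) ⟨
        lookup (us″ ++ⱽ tabulate (var ∘ ρ)) (δ ↑ʳ j) ∎))
    (lookupᴬ 𝐯 x)
  where
  us′ = msubˢ 𝐯 ρ′ σ′ us
  us″ = msubˢ 𝐯 ρ σ (us [ ts ]ˢ)
msub-after-[] e f (op o 𝐮) = cong (op o) (msub-after-[]ᵐ e f 𝐮)
msub-after-[]ˢ e f []       = refl
msub-after-[]ˢ e f (t ∷ us) = cong₂ _∷_ (msub-after-[] e f t) (msub-after-[]ˢ e f us)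
msub-after-[]ᵐ e f [] = refl
msub-after-[]ᵐ {𝐯 = 𝐯} {ρ} {ρ′} {σ} {σ′} {ts} {ws} e f (_∷_ {x = δ} t 𝐮) =
  cong₂ _∷_
    (msub-after-[]
      (↑-elim δ _
        (λ i → begin
          lookup (↑ˢ δ ws) (lift δ σ′ (i ↑ˡ _))  ≡⟨ cong (lookup (↑ˢ δ ws)) (lift-↑ˡ δ σ′ i) ⟩
          lookup (↑ˢ δ ws) (i ↑ˡ _)              ≡⟨ lookup-↑ˢ-↑ˡ δ ws i ⟩
          var (i ↑ˡ _)                           ≡⟨ cong var (lift-↑ˡ δ σ i) ⟨
          msub 𝐯 ((δ ↑ʳ_) ∘ ρ) (lift δ σ) (var (i ↑ˡ _))
            ≡⟨ cong (msub 𝐯 _ (lift δ σ)) (lookup-↑ˢ-↑ˡ δ ts i) ⟨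
          msub 𝐯 _ (lift δ σ) (lookup (↑ˢ δ ts) (i ↑ˡ _)) ∎)
        (λ j → begin
          lookup (↑ˢ δ ws) (lift δ σ′ (δ ↑ʳ j))  ≡⟨ cong (lookup (↑ˢ δ ws)) (lift-↑ʳ δ σ′ j) ⟩
          lookup (↑ˢ δ ws) (δ ↑ʳ σ′ j)           ≡⟨ lookup-↑ˢ-↑ʳ δ ws (σ′ j) ⟩
          ren (δ ↑ʳ_) (lookup ws (σ′ j))         ≡⟨ cong (ren (δ ↑ʳ_)) (e j) ⟩
          -- Weakening the result is traded for weakening the argument: both amount to composing the
          -- two inclusions with `δ ↑ʳ_`.
          ren (δ ↑ʳ_) (msub 𝐯 ρ σ (lookup ts j)) ≡⟨ ren-msub (λ _ → refl) (λ _ → refl) (lookup ts j) ⟩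
          msub 𝐯 ((δ ↑ʳ_) ∘ ρ) ((δ ↑ʳ_) ∘ σ) (lookup ts j)
            ≡⟨ msub-wk (λ _ → refl) (lift-↑ʳ δ σ) (lookup ts j) ⟨
          msub 𝐯 _ (lift δ σ) (ren (δ ↑ʳ_) (lookup ts j))
            ≡⟨ cong (msub 𝐯 _ (lift δ σ)) (lookup-↑ˢ-↑ʳ δ ts j) ⟨
          msub 𝐯 _ (lift δ σ) (lookup (↑ˢ δ ts) (δ ↑ʳ j)) ∎))
      (λ j → trans (lookup-↑ˢ-↑ʳ δ ws (ρ′ j)) (cong (ren (δ ↑ʳ_)) (f j)))
      t)
    (msub-after-[]ᵐ e f 𝐮)

-- Associativity of metavariable substitution. The three hypotheses say that each of the scopes `γ`,
-- `δ′` and `δ` reaches `κ` by the same inclusion along either route.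
msub-msub  : {𝐭 : MSub Σ θ δ′ ξ} {𝐯 : MSub Σ θ₁ δ θ} {ρ₁ : Fin δ′ → Fin κ₁} {σ₁ : Fin γ → Fin κ₁}
             {ρ : Fin δ → Fin κ} {σ : Fin κ₁ → Fin κ} {ρ₀ : Fin δ → Fin κ₀} {σ₀ : Fin δ′ → Fin κ₀}
             {ρ₂ : Fin κ₀ → Fin κ} {σ₂ : Fin γ → Fin κ} →
             σ ∘ σ₁ ≗ σ₂ → σ ∘ ρ₁ ≗ ρ₂ ∘ σ₀ → ρ ≗ ρ₂ ∘ ρ₀ → (t : Tm Σ ξ γ) →
             msub 𝐯 ρ σ (msub 𝐭 ρ₁ σ₁ t) ≡ msub (msubᵐ 𝐯 ρ₀ σ₀ 𝐭) ρ₂ σ₂ t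
msub-msubˢ : {𝐭 : MSub Σ θ δ′ ξ} {𝐯 : MSub Σ θ₁ δ θ} {ρ₁ : Fin δ′ → Fin κ₁} {σ₁ : Fin γ → Fin κ₁}
             {ρ : Fin δ → Fin κ} {σ : Fin κ₁ → Fin κ} {ρ₀ : Fin δ → Fin κ₀} {σ₀ : Fin δ′ → Fin κ₀}
             {ρ₂ : Fin κ₀ → Fin κ} {σ₂ : Fin γ → Fin κ} →
             σ ∘ σ₁ ≗ σ₂ → σ ∘ ρ₁ ≗ ρ₂ ∘ σ₀ → ρ ≗ ρ₂ ∘ ρ₀ → (ts : Sub Σ ξ γ n) →
             msubˢ 𝐯 ρ σ (msubˢ 𝐭 ρ₁ σ₁ ts) ≡ msubˢ (msubᵐ 𝐯 ρ₀ σ₀ 𝐭) ρ₂ σ₂ ts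
msub-msubᵐ : {𝐭 : MSub Σ θ δ′ ξ} {𝐯 : MSub Σ θ₁ δ θ} {ρ₁ : Fin δ′ → Fin κ₁} {σ₁ : Fin γ → Fin κ₁}
             {ρ : Fin δ → Fin κ} {σ : Fin κ₁ → Fin κ} {ρ₀ : Fin δ → Fin κ₀} {σ₀ : Fin δ′ → Fin κ₀}
             {ρ₂ : Fin κ₀ → Fin κ} {σ₂ : Fin γ → Fin κ} →
             σ ∘ σ₁ ≗ σ₂ → σ ∘ ρ₁ ≗ ρ₂ ∘ σ₀ → ρ ≗ ρ₂ ∘ ρ₀ → (𝐮 : MSub Σ ξ γ θ₂) →
             msubᵐ 𝐯 ρ σ (msubᵐ 𝐭 ρ₁ σ₁ 𝐮) ≡ msubᵐ (msubᵐ 𝐯 ρ₀ σ₀ 𝐭) ρ₂ σ₂ 𝐮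
msub-msub e f g (var x) = cong var (e x)
msub-msub {𝐭 = 𝐭} {𝐯} {ρ₁} {σ₁} {ρ} {σ} {ρ₀} {σ₀} {ρ₂} {σ₂} e f g (mvar {δ = δ} x ts) = begin
  -- The entry of `𝐭` at `x` is not a subterm, so no induction hypothesis covers it; `msub-after-[]`
  -- moves `𝐯` past the instantiation, and induction is spent on the arguments only.
  msub 𝐯 ρ σ (lookupᴬ 𝐭 x [ ts′ ++ⱽ tabulate (var ∘ ρ₁) ])
    ≡⟨ msub-after-[]
         (↑-elim δ _
           (λ i → begin
             lookup ws (lift δ σ₀ (i ↑ˡ _))       ≡⟨ cong (lookup ws) (lift-↑ˡ δ σ₀ i) ⟩
             lookup ws (i ↑ˡ _)                   ≡⟨ lookup-++ˡ ts″ _ i ⟩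
             lookup ts″ i                         ≡⟨ cong (λ z → lookup z i) (msub-msubˢ e f g ts) ⟨
             lookup (msubˢ 𝐯 ρ σ ts′) i           ≡⟨ lookup-msubˢ 𝐯 ρ σ ts′ i ⟩
             msub 𝐯 ρ σ (lookup ts′ i)            ≡⟨ cong (msub 𝐯 ρ σ) (lookup-++ˡ ts′ _ i) ⟨
             msub 𝐯 ρ σ (lookup (ts′ ++ⱽ tabulate (var ∘ ρ₁)) (i ↑ˡ _)) ∎)
           (λ j → begin
             lookup ws (lift δ σ₀ (δ ↑ʳ j))       ≡⟨ cong (lookup ws) (lift-↑ʳ δ σ₀ j) ⟩
             lookup ws (δ ↑ʳ σ₀ j)                ≡⟨ ws-↑ʳ (σ₀ j) ⟩
             var (ρ₂ (σ₀ j))                      ≡⟨ cong var (f j) ⟨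
             msub 𝐯 ρ σ (var (ρ₁ j))
               ≡⟨ cong (msub 𝐯 ρ σ) (trans (lookup-++ʳ ts′ _ j) (lookup∘tabulate _ j)) ⟨
             msub 𝐯 ρ σ (lookup (ts′ ++ⱽ tabulate (var ∘ ρ₁)) (δ ↑ʳ j)) ∎))
         (λ j → trans (ws-↑ʳ (ρ₀ j)) (cong var (sym (g j))))
         (lookupᴬ 𝐭 x) ⟨
  msub 𝐯 ((δ ↑ʳ_) ∘ ρ₀) (lift δ σ₀) (lookupᴬ 𝐭 x) [ ws ]
    ≡⟨ cong (_[ ws ]) (lookup-msubᵐ 𝐯 ρ₀ σ₀ 𝐭 x) ⟨
  lookupᴬ (msubᵐ 𝐯 ρ₀ σ₀ 𝐭) x [ ws ] ∎
  where
  ts′ = msubˢ 𝐭 ρ₁ σ₁ ts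
  ts″ = msubˢ (msubᵐ 𝐯 ρ₀ σ₀ 𝐭) ρ₂ σ₂ ts
  ws  = ts″ ++ⱽ tabulate (var ∘ ρ₂)
  ws-↑ʳ : ∀ j → lookup ws (δ ↑ʳ j) ≡ var (ρ₂ j)
  ws-↑ʳ j = trans (lookup-++ʳ ts″ _ j) (lookup∘tabulate _ j)
msub-msub e f g (op o 𝐮) = cong (op o) (msub-msubᵐ e f g 𝐮)
msub-msubˢ e f g []       = refl
msub-msubˢ e f g (t ∷ ts) = cong₂ _∷_ (msub-msub e f g t) (msub-msubˢ e f g ts)
msub-msubᵐ e f g [] = refl
msub-msubᵐ {ρ₁ = ρ₁} {σ = σ} e f g (_∷_ {x = δ} t 𝐮) =
  cong₂ _∷_
    (msub-msub (lift-∘ δ e)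
      (λ j → trans (lift-↑ʳ δ σ (ρ₁ j)) (cong (δ ↑ʳ_) (f j)))
      (λ j → cong (δ ↑ʳ_) (g j)) t)
    (msub-msubᵐ e f g 𝐮)

msub-⟦⟧ : {𝐯 : MSub Σ θ₁ δ θ} {ρ : Fin δ → Fin κ} {σ : Fin γ → Fin κ} (t : Tm Σ ξ δ′) (𝐭 : MSub Σ θ γ ξ) →
          msub 𝐯 ((δ′ ↑ʳ_) ∘ ρ) (lift δ′ σ) (t ⟦ 𝐭 ⟧) ≡ t ⟦ msubᵐ 𝐯 ρ σ 𝐭 ⟧
msub-⟦⟧ {δ′ = δ′} {σ = σ} t 𝐭 = msub-msub (lift-↑ˡ δ′ σ) (lift-↑ʳ δ′ σ) (λ _ → refl) t

msub-⟦⟧₀ : {𝐯 : MSub Σ θ₁ δ θ} {ρ : Fin δ → Fin κ} {σ : Fin γ → Fin κ} (t : Tm Σ ξ 0) (𝐭 : MSub Σ θ γ ξ) →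
           msub 𝐯 ρ σ (t ⟦ 𝐭 ⟧) ≡ t ⟦ msubᵐ 𝐯 ρ σ 𝐭 ⟧
msub-⟦⟧₀ t 𝐭 = msub-msub (λ ()) (λ _ → refl) (λ _ → refl) t

msub-⟦⟧₀ᵐ : {𝐯 : MSub Σ θ₁ δ θ} {ρ : Fin δ → Fin κ} {σ : Fin γ → Fin κ} (𝐮 : MSub Σ ξ 0 θ₂) (𝐭 : MSub Σ θ γ ξ) →
            msubᵐ 𝐯 ρ σ (𝐮 ⟦ 𝐭 ⟧ᵐ) ≡ 𝐮 ⟦ msubᵐ 𝐯 ρ σ 𝐭 ⟧ᵐ
msub-⟦⟧₀ᵐ 𝐮 𝐭 = msub-msubᵐ (λ ()) (λ _ → refl) (λ _ → refl) 𝐮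

-- Extended contexts

-- Using Lifted B instead of typed substitutions avoids having to know that the
-- extended target context is well formed, which is only established together
-- with the substituted judgment.

SubClass : Sig → MScope → Set₁
SubClass Σ θ = ∀ {γ δ} → Ctx Σ θ γ → Ctx Σ θ δ → Sub Σ θ γ δ → Set

data Lifted (B : SubClass Σ θ) : SubClass Σ θ where
  base : {Γ : Ctx Σ θ γ} {Δ : Ctx Σ θ δ} {vs : Sub Σ θ γ δ} → B Γ Δ vs → Lifted B Γ Δ vs
  bind : {Γ : Ctx Σ θ γ} {Δ : Ctx Σ θ δ} {vs : Sub Σ θ γ δ} {T : Tm Σ θ δ} →
         Lifted B Γ Δ vs → Lifted B (Γ ▹ T [ vs ]) (Δ ▹ T) (↑ˢ 1 vs)

-- `msub-∷` binds a whole context at once. Iterating `bind` gives the required context because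
-- lifting turns `T ⟦ 𝐭 ⟧` into `T ⟦ 𝐭 [ vs ]ᵐ ⟧`.
bind-▹▹ : {B : SubClass Σ θ} {Γ : Ctx Σ θ γ₁} {Δ : Ctx Σ θ γ₂} {vs : Sub Σ θ γ₁ γ₂} →
          Lifted B Γ Δ vs → (Δ′ : Ctx Σ ξ δ) (𝐭 : MSub Σ θ γ₂ ξ) →
          Lifted B (Γ ▹▹ Δ′ ⟦ 𝐭 [ vs ]ᵐ ⟧ᵗ) (Δ ▹▹ Δ′ ⟦ 𝐭 ⟧ᵗ) (↑ˢ δ vs)
bind-▹▹ {B = B} {vs = vs} p ε 𝐭 = subst (Lifted B _ _) (sym (↑ˢ-zero vs)) p
bind-▹▹ {B = B} {Γ = Γ} {Δ} {vs} p (_▹_ {γ′ = δ} Δ′ T) 𝐭 =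
  subst₂ (λ U ws → Lifted B (Γ ▹▹ Δ′ ⟦ 𝐭 [ vs ]ᵐ ⟧ᵗ ▹ U) (Δ ▹▹ Δ′ ⟦ 𝐭 ⟧ᵗ ▹ T ⟦ 𝐭 ⟧) ws)
    (⟦⟧-[↑ˢ] T 𝐭 vs) (sym (↑ˢ-suc δ vs)) (bind (bind-▹▹ p Δ′ 𝐭))

-- Ext 𝐯 Γ K Δ ρ σ says that K is Γ.Δ[𝐯], with ρ and σ the inclusions of the
-- scopes of Γ and Δ.  Keeping its scope abstract makes it closed under binders
-- without reassociating sums of scopes.

data Ext (𝐯 : MSub Σ θ₁ γ θ₂) (Γ : Ctx Σ θ₁ γ) :
         Ctx Σ θ₁ κ → Ctx Σ θ₂ δ → (Fin γ → Fin κ) → (Fin δ → Fin κ) → Set where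
  base : {ρ : Fin γ → Fin γ} {σ : Fin 0 → Fin γ} → ρ ≗ id → Ext 𝐯 Γ Γ ε ρ σ
  bind : {K : Ctx Σ θ₁ κ} {Δ : Ctx Σ θ₂ δ} {T : Tm Σ θ₂ δ}
         {ρ : Fin γ → Fin κ} {ρ′ : Fin γ → Fin (suc κ)}
         {σ : Fin δ → Fin κ} {σ′ : Fin (suc δ) → Fin (suc κ)} →
         Ext 𝐯 Γ K Δ ρ σ → suc ∘ ρ ≗ ρ′ → lift 1 σ ≗ σ′ →
         Ext 𝐯 Γ (K ▹ msub 𝐯 ρ σ T) (Δ ▹ T) ρ′ σ′

bind-▹▹ᵐ : {𝐯 : MSub Σ θ₁ γ θ₂} {Γ : Ctx Σ θ₁ γ} {K : Ctx Σ θ₁ κ} {Δ : Ctx Σ θ₂ δ}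
           {ρ : Fin γ → Fin κ} {σ : Fin δ → Fin κ} →
           Ext 𝐯 Γ K Δ ρ σ → (Δ′ : Ctx Σ ξ δ′) (𝐭 : MSub Σ θ₂ δ ξ) →
           Ext 𝐯 Γ (K ▹▹ Δ′ ⟦ msubᵐ 𝐯 ρ σ 𝐭 ⟧ᵗ) (Δ ▹▹ Δ′ ⟦ 𝐭 ⟧ᵗ) ((δ′ ↑ʳ_) ∘ ρ) (lift δ′ σ)
bind-▹▹ᵐ p ε 𝐭 = p
bind-▹▹ᵐ {𝐯 = 𝐯} {Γ} {K} {Δ} {ρ} {σ} p (_▹_ {γ′ = δ′} Δ′ T) 𝐭 =
  subst (λ U → Ext 𝐯 Γ (K ▹▹ Δ′ ⟦ msubᵐ 𝐯 ρ σ 𝐭 ⟧ᵗ ▹ U) (Δ ▹▹ Δ′ ⟦ 𝐭 ⟧ᵗ ▹ T ⟦ 𝐭 ⟧)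
                 ((suc δ′ ↑ʳ_) ∘ ρ) (lift (suc δ′) σ))
    (msub-⟦⟧ T 𝐭)
    (bind (bind-▹▹ᵐ p Δ′ 𝐭) (λ _ → refl) (λ { zero → refl ; (suc _) → refl }))

-- The pointwise hypotheses of `bind` are needed here: `lift 1 (_↑ˡ γ)` and `_↑ˡ γ` agree only after
-- a case split on the variable.
ext-▹▹ : (𝐯 : MSub Σ θ₁ γ θ₂) (Γ : Ctx Σ θ₁ γ) (Δ : Ctx Σ θ₂ δ) →
         Ext 𝐯 Γ (Γ ▹▹ Δ ⟦ 𝐯 ⟧ᵗ) Δ (δ ↑ʳ_) (_↑ˡ γ)
ext-▹▹ 𝐯 Γ ε       = base (λ _ → refl)
ext-▹▹ 𝐯 Γ (Δ ▹ T) = bind (ext-▹▹ 𝐯 Γ Δ) (λ _ → refl) (λ { zero → refl ; (suc _) → refl })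

module _ {𝐯 : MSub Σ θ₁ γ θ₂} {Γ : Ctx Σ θ₁ γ} where

  -- Each `bind` adds one weakening, which is absorbed into the inclusion. This types the identity
  -- on `Γ` over `K`; `typeOf-σ` does the same for the variables of `Δ`.
  typeOf-ρ : {K : Ctx Σ θ₁ κ} {Δ : Ctx Σ θ₂ δ} {ρ : Fin γ → Fin κ} {σ : Fin δ → Fin κ} →
             Ext 𝐯 Γ K Δ ρ σ → ∀ i → typeOf K (ρ i) ≡ ren ρ (typeOf Γ i)
  typeOf-ρ (base e) i = trans (cong (typeOf Γ) (e i)) (sym (ren-id e (typeOf Γ i)))
  typeOf-ρ (bind {K = K} {ρ = ρ} {ρ′} p e f) i = begin
    typeOf (K ▹ _) (ρ′ i)            ≡⟨ cong (typeOf (K ▹ _)) (e i) ⟨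
    ren suc (typeOf K (ρ i))         ≡⟨ cong (ren suc) (typeOf-ρ p i) ⟩
    ren suc (ren ρ (typeOf Γ i))     ≡⟨ ren-ren e (typeOf Γ i) ⟩
    ren ρ′ (typeOf Γ i)              ∎

  typeOf-σ : {K : Ctx Σ θ₁ κ} {Δ : Ctx Σ θ₂ δ} {ρ : Fin γ → Fin κ} {σ : Fin δ → Fin κ} →
             Ext 𝐯 Γ K Δ ρ σ → ∀ x → typeOf K (σ x) ≡ msub 𝐯 ρ σ (typeOf Δ x)
  typeOf-σ (bind {K = K} {T = T} {ρ} {ρ′} {σ} {σ′} p e f) zero = begin
    typeOf (K ▹ _) (σ′ zero)          ≡⟨ cong (typeOf (K ▹ _)) (f zero) ⟨
    ren suc (msub 𝐯 ρ σ T)            ≡⟨ ren-msub e (λ _ → refl) T ⟩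
    msub 𝐯 ρ′ (suc ∘ σ) T             ≡⟨ msub-wk (λ _ → refl) (λ i → sym (f (suc i))) T ⟨
    msub 𝐯 ρ′ σ′ (ren suc T)          ∎
  typeOf-σ (bind {K = K} {Δ} {ρ = ρ} {ρ′} {σ} {σ′} p e f) (suc x) = begin
    typeOf (K ▹ _) (σ′ (suc x))             ≡⟨ cong (typeOf (K ▹ _)) (f (suc x)) ⟨
    ren suc (typeOf K (σ x))                ≡⟨ cong (ren suc) (typeOf-σ p x) ⟩
    ren suc (msub 𝐯 ρ σ (typeOf Δ x))       ≡⟨ ren-msub e (λ _ → refl) (typeOf Δ x) ⟩
    msub 𝐯 ρ′ (suc ∘ σ) (typeOf Δ x)
      ≡⟨ msub-wk (λ _ → refl) (λ i → sym (f (suc i))) (typeOf Δ x) ⟨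
    msub 𝐯 ρ′ σ′ (ren suc (typeOf Δ x))     ∎

-- `_⟦_⟧ʲ_` with arbitrary inclusions, so that the induction can pass under binders while the target
-- scope stays abstract.
msubʲ : MSub Σ θ₁ γ θ₂ → Ctx Σ θ₁ γ → (Fin γ → Fin κ) → (Fin δ → Fin κ) →
        Jdg Σ θ₂ δ → Jdg Σ θ₁ κ
msubʲ 𝐯 Γ ρ σ wf        = wf
msubʲ 𝐯 Γ ρ σ (T sort)  = msub 𝐯 ρ σ T sort
msubʲ 𝐯 Γ ρ σ (t ∶ T)   = msub 𝐯 ρ σ t ∶ msub 𝐯 ρ σ T
msubʲ 𝐯 Γ ρ σ (ts ∶ˢ Δ) = (msubˢ 𝐯 ρ σ ts ++ⱽ tabulate (var ∘ ρ)) ∶ˢ (Γ ▹▹ Δ ⟦ 𝐯 ⟧ᵗ)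
msubʲ 𝐯 Γ ρ σ (𝐭 ∶ᵐ Ξ)  = msubᵐ 𝐯 ρ σ 𝐭 ∶ᵐ Ξ

msubʲ-⟦⟧ʲ : (𝐯 : MSub Σ θ₁ γ θ₂) (Γ : Ctx Σ θ₁ γ) (J : Jdg Σ θ₂ δ) →
            msubʲ 𝐯 Γ (δ ↑ʳ_) (_↑ˡ γ) J ≡ J ⟦ 𝐯 ⟧ʲ Γ
msubʲ-⟦⟧ʲ 𝐯 Γ wf       = refl
msubʲ-⟦⟧ʲ 𝐯 Γ (_ sort) = refl
msubʲ-⟦⟧ʲ 𝐯 Γ (_ ∶ _)  = refl
msubʲ-⟦⟧ʲ 𝐯 Γ (_ ∶ˢ _) = refl
msubʲ-⟦⟧ʲ 𝐯 Γ (_ ∶ᵐ _) = refl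

wk-there-⟦⟧ : (T : Tm Σ θ₂ δ) (t : Tm Σ θ₁ (δ′ + γ)) (𝐯 : MSub Σ θ₁ γ θ₂) →
              wk id there id T ⟦ _∷_ {x = δ′} t 𝐯 ⟧ ≡ T ⟦ 𝐯 ⟧
wk-there-⟦⟧ T t 𝐯 = msub-wk (λ _ → refl) (λ _ → refl) T

wk-there-⟦⟧ᵗ : (Δ : Tel Σ θ₂ κ δ) (t : Tm Σ θ₁ (δ′ + γ)) (𝐯 : MSub Σ θ₁ γ θ₂) →
               wkᵗ id there Δ ⟦ _∷_ {x = δ′} t 𝐯 ⟧ᵗ ≡ Δ ⟦ 𝐯 ⟧ᵗ
wk-there-⟦⟧ᵗ ε t 𝐯       = refl
wk-there-⟦⟧ᵗ (Δ ▹ T) t 𝐯 = cong₂ _▹_ (wk-there-⟦⟧ᵗ Δ t 𝐯) (wk-there-⟦⟧ T t 𝐯)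

⟦⟧-[++ρ] : {𝐯 : MSub Σ θ₁ γ θ₂} {ρ : Fin γ → Fin κ} {σ : Fin δ → Fin κ}
           (T : Tm Σ θ₂ δ′) (ts : Sub Σ θ₂ δ δ′) →
           T ⟦ 𝐯 ⟧ [ msubˢ 𝐯 ρ σ ts ++ⱽ tabulate (var ∘ ρ) ] ≡ msub 𝐯 ρ σ (T [ ts ])
⟦⟧-[++ρ] {𝐯 = 𝐯} {ρ} {σ} T ts = msub-after-[]
  (λ i → trans (lookup-++ˡ (msubˢ 𝐯 ρ σ ts) _ i) (lookup-msubˢ 𝐯 ρ σ ts i))
  (λ j → trans (lookup-++ʳ (msubˢ 𝐯 ρ σ ts) _ j) (lookup∘tabulate _ j)) T

module _ {Σ : Sig} {𝕋 : Theory Σ} where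

  -- Conversion

  -- Both sides of a rewrite rule live over the empty scope of variables, so `vs` passes into the
  -- instantiating `𝐭` and a step remains a single step.
  ⟶-[]  : {t t′ : Tm Σ θ γ₂} (vs : Sub Σ θ γ₁ γ₂) → 𝕋 ∣ t ⟶ t′ → 𝕋 ∣ t [ vs ] ⟶ t′ [ vs ]
  ⟶-[]ˢ : {ts ts′ : Sub Σ θ γ₂ δ} (vs : Sub Σ θ γ₁ γ₂) →
          𝕋 ∣ ts ⟶ˢ ts′ → 𝕋 ∣ ts [ vs ]ˢ ⟶ˢ ts′ [ vs ]ˢ
  ⟶-[]ᵐ : {𝐭 𝐭′ : MSub Σ θ γ₂ ξ} (vs : Sub Σ θ γ₁ γ₂) →
          𝕋 ∣ 𝐭 ⟶ᵐ 𝐭′ → 𝕋 ∣ 𝐭 [ vs ]ᵐ ⟶ᵐ 𝐭′ [ vs ]ᵐ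
  ⟶-[] vs (root {d = d} {𝐮} {r} R 𝐭) =
    subst₂ (𝕋 ∣_⟶_) (cong (op d) (sym (⟦⟧ᵐ-[]ᵐ ⌜ 𝐮 ⌝ᵐ 𝐭 vs))) (sym (⟦⟧-[] r 𝐭 vs))
      (root R (𝐭 [ vs ]ᵐ))
  ⟶-[] vs (mvar s) = mvar (⟶-[]ˢ vs s)
  ⟶-[] vs (op s)   = op (⟶-[]ᵐ vs s)
  ⟶-[]ˢ vs (here s)  = here (⟶-[] vs s)
  ⟶-[]ˢ vs (there s) = there (⟶-[]ˢ vs s)
  ⟶-[]ᵐ vs (here {δ = δ} s) = here (⟶-[] (↑ˢ δ vs) s)
  ⟶-[]ᵐ vs (there s)        = there (⟶-[]ᵐ vs s)

  ≈-[] : {t t′ : Tm Σ θ γ₂} (vs : Sub Σ θ γ₁ γ₂) → 𝕋 ∣ t ≈ t′ → 𝕋 ∣ t [ vs ] ≈ t′ [ vs ]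
  ≈-[] vs = Eq.gmap (_[ vs ]) (⟶-[] vs)

  ≈-reflexive : {t u : Tm Σ θ γ} → t ≡ u → 𝕋 ∣ t ≈ u
  ≈-reflexive refl = Eq.reflexive _

  ≈-ren : {t t′ : Tm Σ θ γ₂} (r : Fin γ₂ → Fin γ₁) → 𝕋 ∣ t ≈ t′ → 𝕋 ∣ ren r t ≈ ren r t′
  ≈-ren {t = t} {t′} r e =
    subst₂ (𝕋 ∣_≈_) ([tabulate-var] r t) ([tabulate-var] r t′) (≈-[] (tabulate (var ∘ r)) e)

  ≈-∷ˢ : {t t′ : Tm Σ θ γ} {ts ts′ : Sub Σ θ γ δ} →
         𝕋 ∣ t ≈ t′ → EqClosure (𝕋 ∣_⟶ˢ_) ts ts′ → EqClosure (𝕋 ∣_⟶ˢ_) (t ∷ ts) (t′ ∷ ts′)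
  ≈-∷ˢ {t′ = t′} {ts} e es =
    Eq.transitive _ (Eq.gmap (_∷ ts) here e) (Eq.gmap (t′ ∷_) there es)

  ≈-∷ᵐ : {t t′ : Tm Σ θ (δ + γ)} {𝐭 𝐭′ : MSub Σ θ γ ξ} → 𝕋 ∣ t ≈ t′ →
         EqClosure (𝕋 ∣_⟶ᵐ_) 𝐭 𝐭′ → EqClosure (𝕋 ∣_⟶ᵐ_) (_∷_ {x = δ} t 𝐭) (t′ ∷ 𝐭′)
  ≈-∷ᵐ {t′ = t′} {𝐭} e es =
    Eq.transitive _ (Eq.gmap (_∷ 𝐭) here e) (Eq.gmap (t′ ∷_) there es)

  -- Needed for `msub`, which inserts converted arguments into an entry of `𝐯`, where each may occur
  -- any number of times and under binders.
  []-≈  : {vs ws : Sub Σ θ γ₁ γ₂} → (∀ i → 𝕋 ∣ lookup vs i ≈ lookup ws i) →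
          (t : Tm Σ θ γ₂) → 𝕋 ∣ t [ vs ] ≈ t [ ws ]
  []-≈ˢ : {vs ws : Sub Σ θ γ₁ γ₂} → (∀ i → 𝕋 ∣ lookup vs i ≈ lookup ws i) →
          (ts : Sub Σ θ γ₂ δ) → EqClosure (𝕋 ∣_⟶ˢ_) (ts [ vs ]ˢ) (ts [ ws ]ˢ)
  []-≈ᵐ : {vs ws : Sub Σ θ γ₁ γ₂} → (∀ i → 𝕋 ∣ lookup vs i ≈ lookup ws i) →
          (𝐭 : MSub Σ θ γ₂ ξ) → EqClosure (𝕋 ∣_⟶ᵐ_) (𝐭 [ vs ]ᵐ) (𝐭 [ ws ]ᵐ)
  []-≈ e (var x)     = e x
  []-≈ e (mvar x ts) = Eq.gmap (mvar x) mvar ([]-≈ˢ e ts)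
  []-≈ e (op o 𝐭)    = Eq.gmap (op o) op ([]-≈ᵐ e 𝐭)
  []-≈ˢ e []       = Eq.reflexive _
  []-≈ˢ e (t ∷ ts) = ≈-∷ˢ ([]-≈ e t) ([]-≈ˢ e ts)
  []-≈ᵐ e [] = Eq.reflexive _
  []-≈ᵐ {vs = vs} {ws} e (_∷_ {x = δ} t 𝐭) =
    ≈-∷ᵐ
      ([]-≈ (↑-elim δ _
              (λ i → ≈-reflexive (trans (lookup-↑ˢ-↑ˡ δ vs i) (sym (lookup-↑ˢ-↑ˡ δ ws i))))
              (λ j → subst₂ (𝕋 ∣_≈_) (sym (lookup-↑ˢ-↑ʳ δ vs j)) (sym (lookup-↑ˢ-↑ʳ δ ws j))
                       (≈-ren (δ ↑ʳ_) (e j))))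
            t)
      ([]-≈ᵐ e 𝐭)

  -- A single step inside the arguments of a metavariable may be duplicated or
  -- erased, hence the conversions in the conclusions.

  ⟶-msub  : (𝐯 : MSub Σ θ₁ δ θ₂) (ρ : Fin δ → Fin κ) (σ : Fin γ → Fin κ) {t t′ : Tm Σ θ₂ γ} →
            𝕋 ∣ t ⟶ t′ → 𝕋 ∣ msub 𝐯 ρ σ t ≈ msub 𝐯 ρ σ t′
  ⟶-msubˢ : (𝐯 : MSub Σ θ₁ δ θ₂) (ρ : Fin δ → Fin κ) (σ : Fin γ → Fin κ) {ts ts′ : Sub Σ θ₂ γ γ′} →
            𝕋 ∣ ts ⟶ˢ ts′ → ∀ i → 𝕋 ∣ lookup (msubˢ 𝐯 ρ σ ts) i ≈ lookup (msubˢ 𝐯 ρ σ ts′) i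
  ⟶-msubᵐ : (𝐯 : MSub Σ θ₁ δ θ₂) (ρ : Fin δ → Fin κ) (σ : Fin γ → Fin κ) {𝐭 𝐭′ : MSub Σ θ₂ γ ξ} →
            𝕋 ∣ 𝐭 ⟶ᵐ 𝐭′ → EqClosure (𝕋 ∣_⟶ᵐ_) (msubᵐ 𝐯 ρ σ 𝐭) (msubᵐ 𝐯 ρ σ 𝐭′)
  ⟶-msub 𝐯 ρ σ (root {d = d} {𝐮} {r} R 𝐭) =
    subst₂ (𝕋 ∣_≈_) (cong (op d) (sym (msub-⟦⟧₀ᵐ ⌜ 𝐮 ⌝ᵐ 𝐭))) (sym (msub-⟦⟧₀ r 𝐭))
      (Eq.return (root R (msubᵐ 𝐯 ρ σ 𝐭)))
  ⟶-msub 𝐯 ρ σ (mvar {δ = δ} {x} {ts} {ts′} s) = []-≈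
    (↑-elim δ _
      (λ i → subst₂ (𝕋 ∣_≈_) (sym (lookup-++ˡ (msubˢ 𝐯 ρ σ ts) _ i))
               (sym (lookup-++ˡ (msubˢ 𝐯 ρ σ ts′) _ i)) (⟶-msubˢ 𝐯 ρ σ s i))
      (λ j → ≈-reflexive (trans (lookup-++ʳ (msubˢ 𝐯 ρ σ ts) _ j)
               (sym (lookup-++ʳ (msubˢ 𝐯 ρ σ ts′) _ j)))))
    (lookupᴬ 𝐯 x)
  ⟶-msub 𝐯 ρ σ (op {c = c} s) = Eq.gmap (op c) op (⟶-msubᵐ 𝐯 ρ σ s)
  ⟶-msubˢ 𝐯 ρ σ (here s)  zero    = ⟶-msub 𝐯 ρ σ s
  ⟶-msubˢ 𝐯 ρ σ (here s)  (suc i) = Eq.reflexive _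
  ⟶-msubˢ 𝐯 ρ σ (there s) zero    = Eq.reflexive _
  ⟶-msubˢ 𝐯 ρ σ (there s) (suc i) = ⟶-msubˢ 𝐯 ρ σ s i
  ⟶-msubᵐ 𝐯 ρ σ (here {δ = δ} s) = ≈-∷ᵐ (⟶-msub 𝐯 ((δ ↑ʳ_) ∘ ρ) (lift δ σ) s) (Eq.reflexive _)
  ⟶-msubᵐ 𝐯 ρ σ (there s)        = ≈-∷ᵐ (Eq.reflexive _) (⟶-msubᵐ 𝐯 ρ σ s)

  ≈-msub : (𝐯 : MSub Σ θ₁ δ θ₂) (ρ : Fin δ → Fin κ) (σ : Fin γ → Fin κ) {t t′ : Tm Σ θ₂ γ} →
           𝕋 ∣ t ≈ t′ → 𝕋 ∣ msub 𝐯 ρ σ t ≈ msub 𝐯 ρ σ t′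
  -- `gfold` in place of `gmap`, since the image of one step is a conversion.
  ≈-msub 𝐯 ρ σ = Eq.gfold (Eq.isEquivalence _) (msub 𝐯 ρ σ) (⟶-msub 𝐯 ρ σ)

  -- Typing

  ⊢-wf : {Θ : MCtx Σ θ} {Γ : Ctx Σ θ γ} {J : Jdg Σ θ γ} → 𝕋 ∣ Θ ⨟ Γ ⊢ J → 𝕋 ∣ Θ ⨟ Γ ⊢ wf
  ⊢-wf (ctx-ε d)       = ctx-ε d
  ⊢-wf (ctx-▹ d)       = ctx-▹ d
  ⊢-wf (ty-sort _ d)   = ⊢-wf d
  ⊢-wf (ty-var _ d)    = ⊢-wf d
  ⊢-wf (ty-mvar _ d)   = ⊢-wf d
  ⊢-wf (ty-cons _ d _) = ⊢-wf d
  ⊢-wf (ty-dest _ d)   = ⊢-wf d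
  ⊢-wf (ty-conv d _ _) = ⊢-wf d
  ⊢-wf (sub-[] d)      = ⊢-wf d
  ⊢-wf (sub-∷ d _)     = ⊢-wf d
  ⊢-wf (msub-[] d)     = ⊢-wf d
  ⊢-wf (msub-∷ d _)    = ⊢-wf d

  ∶-resp-≡ : {Θ : MCtx Σ θ} {Γ : Ctx Σ θ γ} {t T U : Tm Σ θ γ} →
               T ≡ U → 𝕋 ∣ Θ ⨟ Γ ⊢ t ∶ T → 𝕋 ∣ Θ ⨟ Γ ⊢ t ∶ U
  ∶-resp-≡ refl d = d

  -- Substitution in judgments, relative to a class of substitutions

  module Substitution (Θ : MCtx Σ θ) (B : SubClass Σ θ)
    (base-wf : ∀ {γ δ} {Γ : Ctx Σ θ γ} {Δ : Ctx Σ θ δ} {vs} → B Γ Δ vs → 𝕋 ∣ Θ ⨟ Γ ⊢ wf)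
    -- The well-formedness of `Γ` demanded here is supplied in the `ty-var` case by induction on the
    -- premise of that rule.
    (⊢lookup : ∀ {γ δ} {Γ : Ctx Σ θ γ} {Δ : Ctx Σ θ δ} {vs} → Lifted B Γ Δ vs →
               𝕋 ∣ Θ ⨟ Γ ⊢ wf → ∀ x → 𝕋 ∣ Θ ⨟ Γ ⊢ lookup vs x ∶ typeOf Δ x [ vs ])
    where

    ⊢-[] : {Γ : Ctx Σ θ γ} {Δ : Ctx Σ θ δ} {vs : Sub Σ θ γ δ} {J : Jdg Σ θ δ} →
           Lifted B Γ Δ vs → 𝕋 ∣ Θ ⨟ Δ ⊢ J → 𝕋 ∣ Θ ⨟ Γ ⊢ J [ vs ]ʲ
    -- At a `base` the class itself guarantees the target context; only the types added by `bind`
    -- have to be substituted.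
    ⊢-[] (base b) (ctx-ε _) = base-wf b
    ⊢-[] (base b) (ctx-▹ _) = base-wf b
    ⊢-[] (bind p) (ctx-▹ d) = ctx-▹ (⊢-[] p d)
    ⊢-[] p (ty-sort R d) = ty-sort R (⊢-[] p d)
    ⊢-[] p (ty-var x d)  = ⊢lookup p (⊢-[] p d) x
    ⊢-[] {vs = vs} p (ty-mvar x {ts} d) =
      ∶-resp-≡ (sym ([]-[] (λ i → sym (lookup-[]ˢ ts vs i)) (proj₂ (entryOf Θ x))))
        (ty-mvar x (⊢-[] p d))
    ⊢-[] {vs = vs} p (ty-cons {R = R} {𝐭p} {𝐭} r d e) =
      ∶-resp-≡ (sym eq)
        (ty-cons r (subst (λ z → 𝕋 ∣ Θ ⨟ _ ⊢ z ∶ᵐ _) (⨾-[] 𝐭p 𝐭 vs) (⊢-[] p d))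
          (subst (λ z → 𝕋 ∣ Θ ⨟ _ ⊢ z sort) eq (⊢-[] p e)))
      where
      open ConsRule R
      eq : ⌜ T ⌝ ⟦ 𝐭p ⨾ 𝐯i ⟦ 𝐭p ⨾ 𝐭 ⟧ᵐ ⟧ [ vs ] ≡
           ⌜ T ⌝ ⟦ 𝐭p [ vs ]ᵐ ⨾ 𝐯i ⟦ 𝐭p [ vs ]ᵐ ⨾ 𝐭 [ vs ]ᵐ ⟧ᵐ ⟧
      eq = begin
        ⌜ T ⌝ ⟦ 𝐭p ⨾ 𝐯i ⟦ 𝐭p ⨾ 𝐭 ⟧ᵐ ⟧ [ vs ]
          ≡⟨ ⟦⟧-[] ⌜ T ⌝ _ vs ⟩
        ⌜ T ⌝ ⟦ (𝐭p ⨾ 𝐯i ⟦ 𝐭p ⨾ 𝐭 ⟧ᵐ) [ vs ]ᵐ ⟧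
          ≡⟨ cong (⌜ T ⌝ ⟦_⟧) (⨾-[] 𝐭p (𝐯i ⟦ 𝐭p ⨾ 𝐭 ⟧ᵐ) vs) ⟩
        ⌜ T ⌝ ⟦ 𝐭p [ vs ]ᵐ ⨾ 𝐯i ⟦ 𝐭p ⨾ 𝐭 ⟧ᵐ [ vs ]ᵐ ⟧
          ≡⟨ cong (λ z → ⌜ T ⌝ ⟦ 𝐭p [ vs ]ᵐ ⨾ z ⟧)
               (trans (⟦⟧ᵐ-[]ᵐ 𝐯i (𝐭p ⨾ 𝐭) vs) (cong (𝐯i ⟦_⟧ᵐ) (⨾-[] 𝐭p 𝐭 vs))) ⟩
        ⌜ T ⌝ ⟦ 𝐭p [ vs ]ᵐ ⨾ 𝐯i ⟦ 𝐭p [ vs ]ᵐ ⨾ 𝐭 [ vs ]ᵐ ⟧ᵐ ⟧ ∎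
    ⊢-[] {Γ = Γ} {vs = vs} p (ty-dest {d = d} {R} {𝐭p} {u} {𝐭} r e) =
      subst₂ (λ z T → 𝕋 ∣ Θ ⨟ Γ ⊢ op d z ∶ T) (sym (⨾-[] (u ∷ []) 𝐭 vs))
        (sym (trans (⟦⟧-[] U ((u ∷ 𝐭p) ⨾ 𝐭) vs) (cong (U ⟦_⟧) eq)))
        (ty-dest r (subst (λ z → 𝕋 ∣ Θ ⨟ Γ ⊢ z ∶ᵐ _) eq (⊢-[] p e)))
      where
      open DestRule R
      eq = ⨾-[] (u ∷ 𝐭p) 𝐭 vs
    ⊢-[] {vs = vs} p (ty-conv d e d′) = ty-conv (⊢-[] p d) (≈-[] vs e) (⊢-[] p d′)
    ⊢-[] p (sub-[] d) = sub-[] (⊢-[] p d)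
    ⊢-[] {vs = vs} p (sub-∷ {T = T} {ts} d e) =
      sub-∷ (⊢-[] p d) (∶-resp-≡ ([]-[] (λ i → sym (lookup-[]ˢ ts vs i)) T) (⊢-[] p e))
    ⊢-[] p (msub-[] d) = msub-[] (⊢-[] p d)
    -- The one rule whose premise extends the context, hence the one place where the class must be
    -- closed under binders.
    ⊢-[] {vs = vs} p (msub-∷ {Δ = Δ′} {T} {𝐭} d e) =
      msub-∷ (⊢-[] p d) (∶-resp-≡ (⟦⟧-[↑ˢ] T 𝐭 vs) (⊢-[] (bind-▹▹ p Δ′ 𝐭) e))

  -- Part (1): weakening by one variable, then typed substitutions

  data Weakening (Θ : MCtx Σ θ) : SubClass Σ θ where
    weakening : {Γ : Ctx Σ θ γ} {T : Tm Σ θ γ} → 𝕋 ∣ Θ ⨟ Γ ▹ T ⊢ wf →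
                Weakening Θ (Γ ▹ T) Γ (tabulate (var ∘ suc))

  -- Lifting keeps a weakening variable-valued, so `ty-var` alone types its entries. This breaks the
  -- circle in which typing a lifted substitution would presuppose weakening.
  lookup-weakening : {Θ : MCtx Σ θ} {Γ : Ctx Σ θ γ} {Δ : Ctx Σ θ δ} {vs : Sub Σ θ γ δ} →
                     Lifted (Weakening Θ) Γ Δ vs →
                     ∀ x → ∃ λ y → lookup vs x ≡ var y × typeOf Γ y ≡ typeOf Δ x [ vs ]
  lookup-weakening {Δ = Δ} (base (weakening _)) x =
    suc x , lookup∘tabulate _ x , sym ([tabulate-var] suc (typeOf Δ x))
  lookup-weakening (bind {vs = vs} {T} p) zero = zero , refl , sym (ren-↑ʳ-[↑ˢ] 1 vs T)
  lookup-weakening (bind {Δ = Δ} {vs} p) (suc x) =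
    let y , e , f = lookup-weakening p x in
    suc y , trans (lookup-↑ˢ-↑ʳ 1 vs x) (cong (ren suc) e) ,
    trans (cong (ren suc) f) (sym (ren-↑ʳ-[↑ˢ] 1 vs (typeOf Δ x)))

  ⊢-ren-suc : {Θ : MCtx Σ θ} {Γ : Ctx Σ θ γ} {t T U : Tm Σ θ γ} →
              𝕋 ∣ Θ ⨟ Γ ▹ U ⊢ wf → 𝕋 ∣ Θ ⨟ Γ ⊢ t ∶ T → 𝕋 ∣ Θ ⨟ Γ ▹ U ⊢ ren suc t ∶ ren suc T
  ⊢-ren-suc {Θ = Θ} {Γ} {t} {T} {U} w d =
    subst₂ (λ t T → 𝕋 ∣ Θ ⨟ Γ ▹ U ⊢ t ∶ T) ([tabulate-var] suc t) ([tabulate-var] suc T)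
      (Substitution.⊢-[] Θ (Weakening Θ) (λ { (weakening w) → w })
        (λ {_} {_} {Γ} p w x → let y , e , f = lookup-weakening p x in
          subst₂ (λ t T → 𝕋 ∣ Θ ⨟ Γ ⊢ t ∶ T) (sym e) f (ty-var y w))
        (base (weakening w)) d)

  ⊢lookupˢ : {Θ : MCtx Σ θ} {Γ : Ctx Σ θ γ} {Δ : Ctx Σ θ δ} {vs : Sub Σ θ γ δ} →
             𝕋 ∣ Θ ⨟ Γ ⊢ vs ∶ˢ Δ → ∀ x → 𝕋 ∣ Θ ⨟ Γ ⊢ lookup vs x ∶ typeOf Δ x [ vs ]
  ⊢lookupˢ (sub-∷ {T = T} d e) zero = ∶-resp-≡ (sym (ren-[] (λ _ → refl) T)) e
  ⊢lookupˢ (sub-∷ {Δ = Δ} d e) (suc x) =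
    ∶-resp-≡ (sym (ren-[] (λ _ → refl) (typeOf Δ x))) (⊢lookupˢ d x)

  -- Converse of `⊢lookupˢ`. Well-formedness is a separate argument because an empty `Δ` offers no
  -- entry from which to extract it.
  ⊢tabulateˢ : {Θ : MCtx Σ θ} {Γ : Ctx Σ θ γ} {Δ : Ctx Σ θ δ} {vs : Sub Σ θ γ δ} →
               𝕋 ∣ Θ ⨟ Γ ⊢ wf → (∀ x → 𝕋 ∣ Θ ⨟ Γ ⊢ lookup vs x ∶ typeOf Δ x [ vs ]) →
               𝕋 ∣ Θ ⨟ Γ ⊢ vs ∶ˢ Δ
  ⊢tabulateˢ {Δ = ε} {[]} w d = sub-[] w
  ⊢tabulateˢ {Δ = Δ ▹ T} {v ∷ vs} w d =
    sub-∷
      (⊢tabulateˢ w (λ x → ∶-resp-≡ (ren-[] (λ _ → refl) (typeOf Δ x)) (d (suc x))))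
      (∶-resp-≡ (ren-[] (λ _ → refl) T) (d zero))

  ⊢lookup-lifted : {Θ : MCtx Σ θ} {Γ : Ctx Σ θ γ} {Δ : Ctx Σ θ δ} {vs : Sub Σ θ γ δ} →
                   Lifted (λ Γ Δ vs → 𝕋 ∣ Θ ⨟ Γ ⊢ vs ∶ˢ Δ) Γ Δ vs →
                   𝕋 ∣ Θ ⨟ Γ ⊢ wf → ∀ x → 𝕋 ∣ Θ ⨟ Γ ⊢ lookup vs x ∶ typeOf Δ x [ vs ]
  ⊢lookup-lifted (base d) w x = ⊢lookupˢ d x
  ⊢lookup-lifted (bind {vs = vs} {T} p) w zero =
    ∶-resp-≡ (sym (ren-↑ʳ-[↑ˢ] 1 vs T)) (ty-var zero w)
  -- Inverting `w` shows that the last type of the context is a sort over the shorter one, which is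
  -- therefore well formed; the recursive call needs this.
  ⊢lookup-lifted {Θ = Θ} (bind {Δ = Δ} {vs} p) w@(ctx-▹ d) (suc x) =
    subst₂ (λ t T → 𝕋 ∣ Θ ⨟ _ ⊢ t ∶ T) (sym (lookup-↑ˢ-↑ʳ 1 vs x))
      (sym (ren-↑ʳ-[↑ˢ] 1 vs (typeOf Δ x)))
      (⊢-ren-suc w (⊢lookup-lifted p (⊢-wf d) x))

  ⊢-[] : {Θ : MCtx Σ θ} {Γ : Ctx Σ θ γ} {Δ : Ctx Σ θ δ} {vs : Sub Σ θ γ δ} {J : Jdg Σ θ δ} →
         𝕋 ∣ Θ ⨟ Γ ⊢ vs ∶ˢ Δ → 𝕋 ∣ Θ ⨟ Δ ⊢ J → 𝕋 ∣ Θ ⨟ Γ ⊢ J [ vs ]ʲ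
  ⊢-[] {Θ = Θ} d =
    Substitution.⊢-[] Θ (λ Γ Δ vs → 𝕋 ∣ Θ ⨟ Γ ⊢ vs ∶ˢ Δ) ⊢-wf ⊢lookup-lifted (base d)

  -- Part (2): typed metavariable substitutions

  ⊢lookupᵐ : {Ξ : MCtx Σ θ₁} {Θ : MCtx Σ θ₂} {Γ : Ctx Σ θ₁ γ} {𝐯 : MSub Σ θ₁ γ θ₂} →
             𝕋 ∣ Ξ ⨟ Γ ⊢ 𝐯 ∶ᵐ Θ → (x : δ ∈ θ₂) →
             𝕋 ∣ Ξ ⨟ Γ ▹▹ proj₁ (entryOf Θ x) ⟦ 𝐯 ⟧ᵗ ⊢ lookupᴬ 𝐯 x ∶ proj₂ (entryOf Θ x) ⟦ 𝐯 ⟧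
  -- The declared context and type of an entry mention only earlier metavariables, and `entryOf`
  -- weakens them by `there`; instantiation therefore ignores the head `t`, in this case and the
  -- next.
  ⊢lookupᵐ {Ξ = Ξ} {Γ = Γ} (msub-∷ {Δ = Δ} {T} {𝐯} {t} d e) (here refl) =
    subst₂ (λ Δ T → 𝕋 ∣ Ξ ⨟ Γ ▹▹ Δ ⊢ t ∶ T)
      (sym (wk-there-⟦⟧ᵗ Δ t 𝐯)) (sym (wk-there-⟦⟧ T t 𝐯)) e
  ⊢lookupᵐ {Ξ = Ξ} {Γ = Γ} (msub-∷ {Ξ = Θ} {𝐭 = 𝐯} {t} d e) (there x) =
    subst₂ (λ Δ T → 𝕋 ∣ Ξ ⨟ Γ ▹▹ Δ ⊢ lookupᴬ 𝐯 x ∶ T)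
      (sym (wk-there-⟦⟧ᵗ _ t 𝐯)) (sym (wk-there-⟦⟧ (proj₂ (entryOf Θ x)) t 𝐯)) (⊢lookupᵐ d x)

  module _ {Ξ : MCtx Σ θ₁} {Θ : MCtx Σ θ₂} {Γ : Ctx Σ θ₁ γ} {𝐯 : MSub Σ θ₁ γ θ₂}
           (⊢𝐯 : 𝕋 ∣ Ξ ⨟ Γ ⊢ 𝐯 ∶ᵐ Θ) where

    ⊢-msub : {K : Ctx Σ θ₁ κ} {Δ : Ctx Σ θ₂ δ} {ρ : Fin γ → Fin κ} {σ : Fin δ → Fin κ}
             {J : Jdg Σ θ₂ δ} → Ext 𝐯 Γ K Δ ρ σ →
             𝕋 ∣ Θ ⨟ Δ ⊢ J → 𝕋 ∣ Ξ ⨟ K ⊢ msubʲ 𝐯 Γ ρ σ J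
    -- Here `Δ` is empty and `K` is `Γ`, whose well-formedness is contained in the typing of `𝐯`.
    ⊢-msub (base _) (ctx-ε _)     = ⊢-wf ⊢𝐯
    ⊢-msub (bind p _ _) (ctx-▹ d) = ctx-▹ (⊢-msub p d)
    ⊢-msub p (ty-sort R d) = ty-sort R (⊢-msub p d)
    ⊢-msub {σ = σ} p (ty-var x d) = ∶-resp-≡ (typeOf-σ p x) (ty-var (σ x) (⊢-msub p d))
    ⊢-msub p (ty-mvar x {ts} d) =
      ∶-resp-≡ (⟦⟧-[++ρ] (proj₂ (entryOf Θ x)) ts) (⊢-[] (⊢-msub p d) (⊢lookupᵐ ⊢𝐯 x))
    ⊢-msub {ρ = ρ} {σ} p (ty-cons {R = R} {𝐭p} {𝐭} r d e) =
      ∶-resp-≡ (sym eq)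
        (ty-cons r (subst (λ z → 𝕋 ∣ Ξ ⨟ _ ⊢ z ∶ᵐ _) (⨾-msub 𝐯 ρ σ 𝐭p 𝐭) (⊢-msub p d))
          (subst (λ z → 𝕋 ∣ Ξ ⨟ _ ⊢ z sort) eq (⊢-msub p e)))
      where
      open ConsRule R
      𝐭p′ = msubᵐ 𝐯 ρ σ 𝐭p
      eq : msub 𝐯 ρ σ (⌜ T ⌝ ⟦ 𝐭p ⨾ 𝐯i ⟦ 𝐭p ⨾ 𝐭 ⟧ᵐ ⟧) ≡
           ⌜ T ⌝ ⟦ 𝐭p′ ⨾ 𝐯i ⟦ 𝐭p′ ⨾ msubᵐ 𝐯 ρ σ 𝐭 ⟧ᵐ ⟧
      eq = begin
        msub 𝐯 ρ σ (⌜ T ⌝ ⟦ 𝐭p ⨾ 𝐯i ⟦ 𝐭p ⨾ 𝐭 ⟧ᵐ ⟧)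
          ≡⟨ msub-⟦⟧₀ ⌜ T ⌝ _ ⟩
        ⌜ T ⌝ ⟦ msubᵐ 𝐯 ρ σ (𝐭p ⨾ 𝐯i ⟦ 𝐭p ⨾ 𝐭 ⟧ᵐ) ⟧
          ≡⟨ cong (⌜ T ⌝ ⟦_⟧) (⨾-msub 𝐯 ρ σ 𝐭p (𝐯i ⟦ 𝐭p ⨾ 𝐭 ⟧ᵐ)) ⟩
        ⌜ T ⌝ ⟦ 𝐭p′ ⨾ msubᵐ 𝐯 ρ σ (𝐯i ⟦ 𝐭p ⨾ 𝐭 ⟧ᵐ) ⟧
          ≡⟨ cong (λ z → ⌜ T ⌝ ⟦ 𝐭p′ ⨾ z ⟧)
               (trans (msub-⟦⟧₀ᵐ 𝐯i (𝐭p ⨾ 𝐭)) (cong (𝐯i ⟦_⟧ᵐ) (⨾-msub 𝐯 ρ σ 𝐭p 𝐭))) ⟩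
        ⌜ T ⌝ ⟦ 𝐭p′ ⨾ 𝐯i ⟦ 𝐭p′ ⨾ msubᵐ 𝐯 ρ σ 𝐭 ⟧ᵐ ⟧ ∎
    ⊢-msub {K = K} {ρ = ρ} {σ} p (ty-dest {d = d} {R} {𝐭p} {u} {𝐭} r e) =
      subst₂ (λ z T → 𝕋 ∣ Ξ ⨟ K ⊢ op d z ∶ T) (sym (⨾-msub 𝐯 ρ σ (u ∷ []) 𝐭))
        (sym (trans (msub-⟦⟧₀ U ((u ∷ 𝐭p) ⨾ 𝐭)) (cong (U ⟦_⟧) eq)))
        (ty-dest r (subst (λ z → 𝕋 ∣ Ξ ⨟ K ⊢ z ∶ᵐ _) eq (⊢-msub p e)))
      where
      open DestRule R
      eq = ⨾-msub 𝐯 ρ σ (u ∷ 𝐭p) 𝐭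
    ⊢-msub {ρ = ρ} {σ} p (ty-conv d e d′) =
      ty-conv (⊢-msub p d) (≈-msub 𝐯 ρ σ e) (⊢-msub p d′)
    -- The empty list translates to the identity on `Γ`, typed over `K` variable by variable; the
    -- well-formedness of `K` comes from the premise by induction.
    ⊢-msub {K = K} {ρ = ρ} p (sub-[] d) =
      ⊢tabulateˢ (⊢-msub p d) λ i →
        subst₂ (λ t T → 𝕋 ∣ Ξ ⨟ K ⊢ t ∶ T)
          (sym (lookup∘tabulate (var ∘ ρ) i))
          (trans (typeOf-ρ p i) (sym ([tabulate-var] ρ (typeOf Γ i))))
          (ty-var (ρ i) (⊢-msub p d))
    ⊢-msub p (sub-∷ {T = T} {ts} d e) =
      sub-∷ (⊢-msub p d) (∶-resp-≡ (sym (⟦⟧-[++ρ] T ts)) (⊢-msub p e))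
    ⊢-msub p (msub-[] d) = msub-[] (⊢-msub p d)
    ⊢-msub p (msub-∷ {Δ = Δ′} {T} {𝐭} d e) =
      msub-∷ (⊢-msub p d) (∶-resp-≡ (msub-⟦⟧ T 𝐭) (⊢-msub (bind-▹▹ᵐ p Δ′ 𝐭) e))

proposition3p8 : ∀ {Σ : Sig} (𝕋 : Theory Σ) →
    (∀ {θ : MScope} {γ δ : Scope}
    (Θ : MCtx Σ θ) (Γ : Ctx Σ θ γ) (Δ : Ctx Σ θ δ) (v : Sub Σ θ γ δ) (J : Jdg Σ θ δ) →
    𝕋 ∣ Θ ⨟ Γ ⊢ v ∶ˢ Δ →
    𝕋 ∣ Θ ⨟ Δ ⊢ J →
    𝕋 ∣ Θ ⨟ Γ ⊢ J [ v ]ʲ)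
    ×
    (∀ {θ ξ : MScope} {γ δ : Scope}
    (Ξ : MCtx Σ ξ) (Θ : MCtx Σ θ) (Γ : Ctx Σ ξ γ) (Δ : Ctx Σ θ δ) (𝐯 : MSub Σ ξ γ θ) (J : Jdg Σ θ δ) →
    𝕋 ∣ Ξ ⨟ Γ ⊢ 𝐯 ∶ᵐ Θ →
    𝕋 ∣ Θ ⨟ Δ ⊢ J →
    𝕋 ∣ Ξ ⨟ Γ ▹▹ Δ ⟦ 𝐯 ⟧ᵗ ⊢ J ⟦ 𝐯 ⟧ʲ Γ)
proposition3p8 𝕋 =
  (λ Θ Γ Δ v J ⊢v d → ⊢-[] {J = J} ⊢v d) ,
  (λ Ξ Θ Γ Δ 𝐯 J ⊢𝐯 d →
    subst (𝕋 ∣ Ξ ⨟ Γ ▹▹ Δ ⟦ 𝐯 ⟧ᵗ ⊢_) (msubʲ-⟦⟧ʲ 𝐯 Γ J) (⊢-msub ⊢𝐯 {J = J} (ext-▹▹ 𝐯 Γ Δ) d))
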